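{- Let $R$ be any one of the four expressions $$t\sqrt{p_{\max}},\qquad (n\,w_{\max}\,p_{\max})^{1/3}t^{2/3},\qquad \mathrm{OPT}\sqrt{w_{\max}},\qquad (n\,w_{\max}\,p_{\max})^{1/3}\mathrm{OPT}^{2/3},$$ and let $z$ be any one of the five parameters $n, w_{\max}, p_{\max}, t, \mathrm{OPT}$. If for some constant $\delta>0$ Knapsack can be solved in time $\widetilde{O}(n + R/z^{\delta})$, then Bounded Min-Plus Convolution Verification can be solved in time $O(n^{2-\varepsilon})$ for some constant $\varepsilon>0$ (where in the latter bound $n$ is the length of the sequences).
   Context: Knapsack (0-1 Knapsack): the input consists of $n$ items, item $i$ having weight $w_i\in\mathbb{N}$ and profit $p_i\in\mathbb{N}$, and a capacity $t\in\mathbb{N}$. The task is to compute $\mathrm{OPT}=\max\{\sum_{i=1}^n p_ix_i : x\in\{0,1\}^n,\ \sum_{i=1}^n w_ix_i\le t\}$. Write $w_{\max}=\max_i w_i$ and $p_{\max}=\max_i p_i$; these parameters are taken to be positive. Bounded Min-Plus Convolution Verification: given sequences $A[0\ldots n-1]$, $B[0\ldots n-1]$ and $C[0\ldots 2n-2]$ with entries in $\{0,1,\ldots,n\}$, determine whether for all $k\in\{0,\dots,2n-2\}$ we have $C[k]\le\min_{i+j=k}(A[i]+B[j])$. $\widetilde{O}(T)=\bigcup_{c\ge0}O(T\log^c(nU))$, where $U$ is the largest number in the input. Running times are in the standard RAM model; "can be solved" refers to the same kind of algorithms (deterministic, or randomized) in hypothesis and conclusion. -}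

module Defs where

open import Data.Bool.Base using (Bool; true; false; if_then_else_)
open import Data.Fin.Base using (Fin; toℕ)
open import Data.Fin.Properties using (all?)
open import Data.Integer.Base using (∣_∣)
open import Data.List.Base
  using (List; []; _∷_; _++_; map; filter; length; head; drop; allFin; cartesianProduct)
open import Data.List.Extrema.Nat using (max; min)
open import Data.Maybe.Base using (Maybe; just; nothing; fromMaybe; maybe′)
open import Data.Maybe.Properties using (≡-dec)
open import Data.Nat.Base
  using (ℕ; zero; suc; _+_; _*_; _∸_; _^_; _/_; _%_; _≤_; _<_; _<ᵇ_; _≡ᵇ_)
open import Data.Nat.Logarithm using (⌊log₂_⌋)
open import Data.Nat.Properties using (_≟_; _≤?_)
open import Data.Product.Base using (_×_; _,_; ∃-syntax)
open import Data.Rational.Base using (ℚ; ↥_; ↧ₙ_)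
open import Data.Vec.Base as Vec using (Vec; []; _∷_; lookup; toList)
open import Relation.Binary.PropositionalEquality.Core using (_≡_)
open import Relation.Nullary.Decidable.Core using (Dec; does)

bitVectors : ∀ n → List (Vec Bool n)
bitVectors zero    = [] ∷ []
bitVectors (suc n) = map (false ∷_) (bitVectors n) ++ map (true ∷_) (bitVectors n)

maximum : List ℕ → ℕ
maximum = max 0

bitLength : ℕ → ℕ
bitLength k = suc ⌊log₂ k ⌋

------------------------------------------------------------------------
-- The random access machine
--
-- Unit-cost RAM with finitely many directly addressed registers (those
-- named by the program), an indirectly addressed memory, and words of
-- bounded length.  A randomized machine may also read a fair coin.

data Mode : Set where
  deterministic randomized : Mode

Reg : Set
Reg = ℕ

data Op : Set where
  add sub mul div mod : Op

data Instr : Mode → Set where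
  const    : ∀ {m} (dst : Reg) (value : ℕ) → Instr m
  arith    : ∀ {m} (op : Op) (dst src₁ src₂ : Reg) → Instr m
  load     : ∀ {m} (dst address : Reg) → Instr m
  store    : ∀ {m} (address src : Reg) → Instr m
  jump     : ∀ {m} (target : ℕ) → Instr m
  jumpLess : ∀ {m} (src₁ src₂ : Reg) (target : ℕ) → Instr m
  flip     : (dst : Reg) → Instr randomized
  halt     : ∀ {m} → Instr m

Program : Mode → Set
Program m = List (Instr m)

record Config : Set where
  constructor ⟨_,_,_⟩
  field
    pc  : ℕ
    reg : Reg → ℕ
    mem : ℕ → ℕ

open Config public

data Outcome : Set where
  continue : Config → Outcome
  output   : ℕ → Outcome
  fault    : Outcome

-- Subtraction is truncated; division by zero is a fault.
evalOp : Op → ℕ → ℕ → Maybe ℕ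
evalOp add x y       = just (x + y)
evalOp sub x y       = just (x ∸ y)
evalOp mul x y       = just (x * y)
evalOp div x zero    = nothing
evalOp div x (suc y) = just (x / suc y)
evalOp mod x zero    = nothing
evalOp mod x (suc y) = just (x % suc y)

_[_≔_] : (ℕ → ℕ) → ℕ → ℕ → (ℕ → ℕ)
(f [ i ≔ v ]) j = if j ≡ᵇ i then v else f j

bit : Bool → ℕ
bit false = 0
bit true  = 1

-- Words are the naturals below W; writing anything larger is a fault, so
-- that a program cannot profit from overlong numbers.
setReg : (W : ℕ) → Config → Reg → ℕ → Outcome
setReg W ⟨ pc , reg , mem ⟩ r v =
  if v <ᵇ W then continue ⟨ suc pc , reg [ r ≔ v ] , mem ⟩ else fault

exec : ∀ {m} → (W : ℕ) → Bool → Instr m → Config → Outcome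
exec W coin (const r v)      c = setReg W c r v
exec W coin (arith op r s u) c =
  maybe′ (setReg W c r) fault (evalOp op (reg c s) (reg c u))
exec W coin (load r a)       c = setReg W c r (mem c (reg c a))
exec W coin (store a s)      c =
  continue ⟨ suc (pc c) , reg c , mem c [ reg c a ≔ reg c s ] ⟩
exec W coin (jump ℓ)         c = continue ⟨ ℓ , reg c , mem c ⟩
exec W coin (jumpLess r s ℓ) c =
  continue ⟨ (if reg c r <ᵇ reg c s then ℓ else suc (pc c)) , reg c , mem c ⟩
exec W coin (flip r)         c = setReg W c r (bit coin)
exec W coin halt             c = output (reg c 0)

step : ∀ {m} → (W : ℕ) → Program m → Bool → Config → Outcome
step W P coin c = maybe′ (λ i → exec W coin i c) fault (head (drop (pc c) P))

-- The output of a run of at most T steps; the i-th coin is the one visible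
-- to the i-th step.
run : ∀ {m T} → (W : ℕ) → Program m → Vec Bool T → Config → Maybe ℕ
run W P []             c = nothing
run W P (coin ∷ coins) c with step W P coin c
... | continue c′ = run W P coins c′
... | output v    = just v
... | fault       = nothing

initial : List ℕ → Config
initial input = ⟨ 0 , (λ _ → 0) , (λ i → fromMaybe 0 (head (drop i input))) ⟩

------------------------------------------------------------------------
-- Problems and their solvability within a time bound

record Problem : Set₁ where
  field
    Instance : Set
    size     : Instance → ℕ
    input    : Instance → List ℕ
    answer   : Instance → ℕ

  -- log(nU), with U the largest number in the input, rounded so as to be
  -- positive.
  logNU : Instance → ℕ
  logNU x = bitLength (size x * maximum (input x))

Correct : ∀ {m T} → (W : ℕ) → Program m → List ℕ → ℕ → Vec Bool T → Set
Correct W P input answer coins = run W P coins (initial input) ≡ just answer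

correct? : ∀ {m T} W (P : Program m) input answer (coins : Vec Bool T) →
           Dec (Correct W P input answer coins)
correct? W P input answer coins = ≡-dec _≟_ (run W P coins (initial input)) (just answer)

-- A randomized program has to be right, within T steps, with probability
-- at least 2/3.
Succeeds : ∀ {m} → (W : ℕ) → Program m → List ℕ → ℕ → (T : ℕ) → Set
Succeeds {deterministic} W P input answer T =
  (coins : Vec Bool T) → Correct W P input answer coins
Succeeds {randomized}    W P input answer T =
  2 * 2 ^ T ≤ 3 * length (filter (correct? W P input answer) (bitVectors T))

-- Words have κ · log(nU) bits for a constant κ.  "Bound x T" says that T
-- steps are within the time allowed on instance x.
SolvableWithin : Mode → (Π : Problem) → (Problem.Instance Π → ℕ → Set) → Set
SolvableWithin m Π Bound =
  ∃[ P ] ∃[ κ ] ∀ (x : Instance) →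
    ∃[ T ] Bound x T × Succeeds {m} (2 ^ (κ * logNU x)) P (input x) (answer x) T
  where open Problem Π

------------------------------------------------------------------------
-- Knapsack

dot : ∀ {n} → Vec ℕ n → Vec Bool n → ℕ
dot v x = Vec.sum (Vec.zipWith (λ vᵢ xᵢ → vᵢ * bit xᵢ) v x)

record KnapsackInstance : Set where
  field
    n        : ℕ
    weights  : Vec ℕ n
    profits  : Vec ℕ n
    capacity : ℕ

  w-max = maximum (toList weights)
  p-max = maximum (toList profits)

  field
    w-max>0 : 0 < w-max
    p-max>0 : 0 < p-max

  -- The all-zero vector is feasible, so the default value of maximum is
  -- immaterial.
  OPT : ℕ
  OPT = maximum (map (dot profits)
    (filter (λ x → dot weights x ≤? capacity) (bitVectors n)))

Knapsack : Problem
Knapsack = record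
  { Instance = KnapsackInstance
  ; size     = n
  ; input    = λ x → n x ∷ capacity x ∷ toList (weights x) ++ toList (profits x)
  ; answer   = OPT
  }
  where open KnapsackInstance

data Parameter : Set where
  `n `w-max `p-max `t `OPT : Parameter

data Expression : Set where
  `t√p-max                 : Expression
  `⟨n·w-max·p-max⟩^⅓·t^⅔   : Expression
  `OPT√w-max               : Expression
  `⟨n·w-max·p-max⟩^⅓·OPT^⅔ : Expression

module _ (x : KnapsackInstance) where
  open KnapsackInstance x renaming (capacity to t)

  value : Parameter → ℕ
  value `n     = n
  value `w-max = w-max
  value `p-max = p-max
  value `t     = t
  value `OPT   = OPT

  -- R⁶, which is a natural number for each of the four expressions R.
  sixthPower : Expression → ℕ
  sixthPower `t√p-max                 = t ^ 6 * p-max ^ 3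
  sixthPower `⟨n·w-max·p-max⟩^⅓·t^⅔   = (n * w-max * p-max) ^ 2 * t ^ 4
  sixthPower `OPT√w-max               = OPT ^ 6 * w-max ^ 3
  sixthPower `⟨n·w-max·p-max⟩^⅓·OPT^⅔ = (n * w-max * p-max) ^ 2 * OPT ^ 4

-- For δ = a / b > 0 and z > 0 this is exactly T ≤ K · (n + R / z^δ), in the
-- form (T − K·n)^(6b) · z^(6a) ≤ K^(6b) · (R⁶)^b.  If z = 0, where R / z^δ
-- is undefined, it holds for every T.
_≤_·[n+_/_^_]on_ : ℕ → ℕ → Expression → Parameter → ℚ → KnapsackInstance → Set
T ≤ K ·[n+ R / z ^ δ ]on x =
  (T ∸ K * KnapsackInstance.n x) ^ (6 * b) * value x z ^ (6 * a)
    ≤ K ^ (6 * b) * sixthPower x R ^ b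
  where
  a = ∣ ↥ δ ∣
  b = ↧ₙ δ

-- Knapsack can be solved in time Õ(n + R / z^δ).
KnapsackIn-Õ[n+_/_^_] : Expression → Parameter → ℚ → Mode → Set
KnapsackIn-Õ[n+ R / z ^ δ ] m =
  ∃[ c ] ∃[ C ] SolvableWithin m Knapsack
    (λ x T → T ≤ C * Problem.logNU Knapsack x ^ c ·[n+ R / z ^ δ ]on x)

------------------------------------------------------------------------
-- Bounded min-plus convolution verification

record ConvolutionInstance : Set where
  field
    n   : ℕ
    n>0 : 0 < n
    A B : Vec (Fin (suc n)) n
    C   : Vec (Fin (suc n)) (2 * n ∸ 1)

  sums : ℕ → List ℕ
  sums k = map (λ (i , j) → toℕ (lookup A i) + toℕ (lookup B j))
    (filter (λ (i , j) → toℕ i + toℕ j ≟ k) (cartesianProduct (allFin n) (allFin n)))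

  -- min_{i+j=k} (A[i] + B[j]).  The minimum of the empty list is given as
  -- n + n, which no sum exceeds; for k ≤ 2n−2 there is at least one sum.
  minPlus : ℕ → ℕ
  minPlus k = min (n + n) (sums k)

  Verified : Set
  Verified = ∀ k → toℕ (lookup C k) ≤ minPlus (toℕ k)

  verified? : Dec Verified
  verified? = all? λ k → toℕ (lookup C k) ≤? minPlus (toℕ k)

BoundedMinPlusVerification : Problem
BoundedMinPlusVerification = record
  { Instance = ConvolutionInstance
  ; size     = n
  ; input    = λ x → n x ∷ map toℕ (toList (A x) ++ toList (B x) ++ toList (C x))
  ; answer   = λ x → bit (does (verified? x))
  }
  where open ConvolutionInstance

-- The verification problem can be solved in time O(n^(2−ε)): for ε = a / b,
-- T ≤ K · n^(2−ε) is T^b · n^a ≤ K^b · n^(2b).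
VerificationIn-O[n^2-_] : ℚ → Mode → Set
VerificationIn-O[n^2- ε ] m =
  ∃[ K ] SolvableWithin m BoundedMinPlusVerification
    (λ x T → T ^ b * n x ^ a ≤ K ^ b * n x ^ (2 * b))
  where
  open ConvolutionInstance using (n)
  a = ∣ ↥ ε ∣
  b = ↧ₙ ε

{-# OPTIONS --safe #-}

-- The entries of A, B and C become the 4N − 1 items of a Knapsack instance.
-- Each item has a coarse value Θ(N) that encodes its class and its index,
-- such that a selection attains a certain total exactly if it consists of
-- A[i], B[j] and C[i+j] for some i and j.  Its fine value is N times the
-- coarse value, corrected by the entry, so that among these selections the
-- fine value tells whether A[i] + B[j] < C[i+j].  With coarse weights and
-- fine profits we get t, w_max = Θ(N) and p_max = Θ(N²); with the two roles
-- exchanged, OPT, p_max = Θ(N) and w_max = Θ(N²).  Either way all five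
-- parameters are at least N, and R = O(N²) for the two expressions R that
-- involve t, respectively OPT.  So Õ(n + R / z^δ) is Õ(N + N^(2−δ)), and
-- ε = 1 / (2b) works for δ = a / b.  The verification program rewrites its
-- input in place, runs the Knapsack program with renumbered registers, and
-- compares the optimum with a threshold.

module Submission where

open import Data.Bool.Base as Bool using (Bool; true; false; if_then_else_)
open import Data.Fin.Base as Fin using (Fin; toℕ; fromℕ<; zero; suc; _↑ˡ_; _↑ʳ_)
open import Data.Fin.Properties using (toℕ<n; toℕ-fromℕ<; toℕ≤pred[n]; toℕ-↑ˡ; toℕ-↑ʳ; all?)
import Data.Integer.Base as ℤ
open import Data.List.Base as List
  using (List; []; _∷_; _++_; map; filter; length; head; drop; allFin; cartesianProduct)
open import Data.List.Extrema.Nat using (max≤v⁺; xs≤max; v≤min⁺; min≤xs)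
open import Data.List.Membership.Propositional using (_∈_)
open import Data.List.Membership.Propositional.Properties
  using (∈-map⁺; ∈-map⁻; ∈-++⁺ˡ; ∈-++⁺ʳ; ∈-filter⁺; ∈-filter⁻; ∈-cartesianProduct⁺; ∈-allFin)
open import Data.List.Properties using (filter-++; length-++; length-map; map-++; ++-identityʳ)
import Data.List.Relation.Unary.All as All
open import Data.List.Relation.Unary.All.Properties using (++⁺)
open import Data.List.Relation.Unary.Any using (here; there)
open import Data.Maybe.Base using (just)
open import Data.Maybe.Properties using (just-injective)
open import Data.Nat.Base
open import Data.Nat.Coprimality using (1-coprimeTo)
open import Data.Nat.DivMod using (m≡m%n+[m/n]*n; m%n<n; m/n*n≤m)
open import Data.Nat.Logarithm using (⌊log₂_⌋; ⌊log₂⌋-mono-≤; ⌊log₂⌊n/2⌋⌋≡⌊log₂n⌋∸1; ⌊log₂[2^n]⌋≡n)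
open import Data.Nat.Properties
open import Data.Nat.Tactic.RingSolver using (solve-∀)
open import Data.Product.Base using (_×_; _,_; ∃-syntax; proj₂)
open import Data.Rational.Base using (ℚ; mkℚ; Positive)
open import Data.Sum.Base using (inj₁; inj₂)
open import Data.Unit.Base using (tt)
open import Data.Vec.Base as Vec using (Vec; []; _∷_; lookup; toList; tabulate)
open import Data.Vec.Properties using (toList-map; lookup-map; lookup∘tabulate)
open import Function.Base using (_∘_)
open import Relation.Binary.PropositionalEquality hiding (J)
open import Relation.Nullary using (¬_; yes; no; contradiction; does)
open import Relation.Nullary.Decidable using (_→-dec_; _×-dec_; toWitness; dec-true; dec-false)
open import Relation.Unary using (Decidable)
open import Defs

-- A feasible selection may contain many items, so its total excess is not known to be below `N` and
-- cannot be treated as a last digit. This fixes the signs: the excess is subtracted from fine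
-- profits but added to fine weights, so that it can only hurt. With fine profits, a coarse weight
-- below the target leaves at most `coarseTarget * N ∸ N` profit, whatever the excess; with fine
-- weights, a coarse profit above the target alone breaks the capacity. Hence a feasible selection
-- that reaches the threshold hits the coarse target exactly, and only then does the factor `N`
-- leave an excess of at most `N ∸ 1`.
--
-- Of the saving N^(a/b) only N^(1/b) is kept. Half of its exponent absorbs the powers of the
-- logarithm, the other half is `ε`; hence the 2 in 1 / (2b).
--
-- The Knapsack program is a black box of which only successful runs within `T` steps are known. The
-- simulation copies such runs instruction by instruction, under wider words. The code before the
-- call uses a number of coins that depends on the input alone, so the coins of the call form a
-- fixed window of the coin string.

private
  variable
    mode : Mode
    W W′ k l τ : ℕ

-- Boolean comparison and pointwise update

<ᵇ-true : ∀ {x y} → x < y → (x <ᵇ y) ≡ true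
<ᵇ-true {x} {y} x<y with x <ᵇ y | <⇒<ᵇ x<y
... | true | _ = refl

<ᵇ-false : ∀ {x y} → y ≤ x → (x <ᵇ y) ≡ false
<ᵇ-false {x} {y} y≤x with x <ᵇ y in eq
... | false = refl
... | true  = contradiction (<ᵇ⇒< x y (subst Bool.T (sym eq) tt)) (≤⇒≯ y≤x)

≔-same : ∀ (f : ℕ → ℕ) i v → (f [ i ≔ v ]) i ≡ v
≔-same f i v with i ≡ᵇ i | ≡⇒≡ᵇ i i refl
... | true | _ = refl

≔-other : ∀ (f : ℕ → ℕ) i v {j} → j ≢ i → (f [ i ≔ v ]) j ≡ f j
≔-other f i v {j} j≢i with j ≡ᵇ i in eq
... | false = refl
... | true  = contradiction (≡ᵇ⇒≡ j i (subst Bool.T (sym eq) tt)) j≢i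

≔-cong : ∀ (f g : ℕ → ℕ) → f ≗ g → ∀ i v → f [ i ≔ v ] ≗ g [ i ≔ v ]
≔-cong f g f≗g i v j with j ≡ᵇ i
... | true  = refl
... | false = f≗g j

-- Executions of RAM programs

infixr 4 _then_

-- Quantifying over the coin restricts this to steps whose effect ignores it, so a `Steps` chain
-- runs under arbitrary coins.
record Step {m} (W : ℕ) (P : Program m) (c c₁ : Config) : Set where
  constructor ⟪_⟫
  field continues : ∀ coin → step W P coin c ≡ continue c₁

open Step

data Steps {m} (W : ℕ) (P : Program m) : Config → ℕ → Config → Set where
  done   : ∀ {c} → Steps W P c 0 c
  _then_ : ∀ {c c₁ c₂} → Step W P c c₁ →
           Steps W P c₁ k c₂ → Steps W P c (suc k) c₂

infixr 3 _followed-by_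

_followed-by_ : ∀ {P : Program mode} {c₁ c₂ c₃} → Steps W P c₁ k c₂ → Steps W P c₂ l c₃ →
                Steps W P c₁ (k + l) c₃
done        followed-by ss′ = ss′
(s then ss) followed-by ss′ = s then (ss followed-by ss′)

run-Steps : ∀ {P : Program mode} {c c′} → Steps W P c k c′ →
            (cs : Vec Bool k) (ds : Vec Bool τ) → run W P (cs Vec.++ ds) c ≡ run W P ds c′
run-Steps done               []       ds = refl
run-Steps (⟪ c→c₁ ⟫ then rest) (b ∷ cs) ds rewrite c→c₁ b = run-Steps rest cs ds

module _ (P : Program mode) {pc : ℕ} {ρ μ : ℕ → ℕ} where

  private
    Goes : (W : ℕ) → Config → Set
    Goes W c = Step W P ⟨ pc , ρ , μ ⟩ c

  step-const : ∀ {r v} → head (drop pc P) ≡ just (const r v) → v < W →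
               Goes W ⟨ suc pc , ρ [ r ≔ v ] , μ ⟩
  continues (step-const at v<W) coin rewrite at | <ᵇ-true v<W = refl

  step-arith : ∀ {op r s u x y v} → head (drop pc P) ≡ just (arith op r s u) →
               ρ s ≡ x → ρ u ≡ y → evalOp op x y ≡ just v → v < W →
               Goes W ⟨ suc pc , ρ [ r ≔ v ] , μ ⟩
  continues (step-arith at refl refl eval v<W) coin rewrite at | eval | <ᵇ-true v<W = refl

  step-load : ∀ {r s x v} → head (drop pc P) ≡ just (load r s) → ρ s ≡ x → μ x ≡ v → v < W →
              Goes W ⟨ suc pc , ρ [ r ≔ v ] , μ ⟩
  continues (step-load at refl refl v<W) coin rewrite at | <ᵇ-true v<W = refl

  step-store : ∀ {r s x v} → head (drop pc P) ≡ just (store r s) → ρ r ≡ x → ρ s ≡ v →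
               Goes W ⟨ suc pc , ρ , μ [ x ≔ v ] ⟩
  continues (step-store at refl refl) coin rewrite at = refl

  step-jump : ∀ {ℓ} → head (drop pc P) ≡ just (jump ℓ) → Goes W ⟨ ℓ , ρ , μ ⟩
  continues (step-jump at) coin rewrite at = refl

  step-less : ∀ {r s x y ℓ} → head (drop pc P) ≡ just (jumpLess r s ℓ) →
              ρ r ≡ x → ρ s ≡ y → x < y → Goes W ⟨ ℓ , ρ , μ ⟩
  continues (step-less at refl refl x<y) coin rewrite at | <ᵇ-true x<y = refl

  step-notLess : ∀ {r s x y ℓ} → head (drop pc P) ≡ just (jumpLess r s ℓ) →
                 ρ r ≡ x → ρ s ≡ y → y ≤ x → Goes W ⟨ suc pc , ρ , μ ⟩
  continues (step-notLess at refl refl y≤x) coin rewrite at | <ᵇ-false y≤x = refl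

-- Calling a program as a subroutine


module Subroutine {m} (pre post : Program m) (P : Program m) where

  exit : ℕ
  exit = length pre + length P

  -- Registers below 20 are left to the caller.
  relocate : Instr m → Instr m
  relocate (const r v)      = const (20 + r) v
  relocate (arith op r s u) = arith op (20 + r) (20 + s) (20 + u)
  relocate (load r s)       = load (20 + r) (20 + s)
  relocate (store r s)      = store (20 + r) (20 + s)
  relocate (jump ℓ)         = jump (length pre + ℓ)
  relocate (jumpLess r s ℓ) = jumpLess (20 + r) (20 + s) (length pre + ℓ)
  relocate (flip r)         = flip (20 + r)
  relocate halt             = jump exit

  whole : Program m
  whole = pre ++ map relocate P ++ post

  drop-pre : ∀ (xs ys : Program m) i → drop (length xs + i) (xs ++ ys) ≡ drop i ys
  drop-pre []       ys i = refl
  drop-pre (x ∷ xs) ys i = drop-pre xs ys i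

  head-relocated : ∀ (xs ys : Program m) i {instr} → head (drop i xs) ≡ just instr →
                   head (drop i (map relocate xs ++ ys)) ≡ just (relocate instr)
  head-relocated []       ys zero    ()
  head-relocated []       ys (suc i) ()
  head-relocated (x ∷ xs) ys zero    refl = refl
  head-relocated (x ∷ xs) ys (suc i) eq   = head-relocated xs ys i eq

  fetch : ∀ i {instr} → head (drop i P) ≡ just instr →
          head (drop (length pre + i) whole) ≡ just (relocate instr)
  fetch i eq = trans (cong head (drop-pre pre (map relocate P ++ post) i)) (head-relocated P post i eq)

  fetch-post : ∀ i → drop (i + exit) whole ≡ drop i post
  fetch-post i = begin
    drop (i + (length pre + length P)) whole    ≡⟨ cong (λ j → drop j whole) (rotate i (length pre) (length P)) ⟩
    drop (length pre + (length P + i)) whole    ≡⟨ drop-pre pre (map relocate P ++ post) _ ⟩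
    drop (length P + i) (map relocate P ++ post)
      ≡⟨ cong (λ j → drop (j + i) (map relocate P ++ post)) (sym (length-map relocate P)) ⟩
    drop (length (map relocate P) + i) (map relocate P ++ post)  ≡⟨ drop-pre (map relocate P) post i ⟩
    drop i post                                 ∎
    where
    open ≡-Reasoning
    rotate : ∀ i j k → i + (j + k) ≡ j + (k + i)
    rotate = solve-∀

  -- `θ` holds the caller's registers at the time of the call. Memory is shared without relocation,
  -- so the caller has to lay out the callee's input from address 0 on.
  record Simulates (θ : Reg → ℕ) (c c′ : Config) : Set where
    constructor simulates
    field
      same-pc  : pc c′ ≡ length pre + pc c
      same-reg : ∀ r → reg c′ (20 + r) ≡ reg c r
      same-mem : mem c′ ≗ mem c
      kept     : ∀ r → r < 20 → reg c′ r ≡ θ r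

  open Simulates

  data Exits (θ : Reg → ℕ) (v : ℕ) : Config → Set where
    exits : ∀ {ρ μ} → ρ 20 ≡ v → (∀ r → r < 20 → ρ r ≡ θ r) → Exits θ v ⟨ exit , ρ , μ ⟩

  module _ {W W′ : ℕ} (W≤W′ : W ≤ W′) {θ : Reg → ℕ} where

    private
      low≢high : ∀ {r s} → r < 20 → r ≢ 20 + s
      low≢high {s = s} r<20 refl = <⇒≱ r<20 (m≤m+n 20 s)

    -- Only writes that do not fault are copied, and a value below `W` is also below `W′`.
    setReg-simulated : ∀ {c c₁ c′ r v} → Simulates θ c c′ → setReg W c r v ≡ continue c₁ →
                       ∃[ c₁′ ] setReg W′ c′ (20 + r) v ≡ continue c₁′ × Simulates θ c₁ c₁′
    setReg-simulated {c} {c₁} {c′} {r} {v} sim eq with v <ᵇ W in v<ᵇW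
    setReg-simulated {c} {c₁} {c′} {r} {v} sim refl | true
      rewrite <ᵇ-true (<-≤-trans (<ᵇ⇒< v W (subst Bool.T (sym v<ᵇW) tt)) W≤W′) =
      _ , refl , simulates
        (trans (cong suc (same-pc sim)) (sym (+-suc (length pre) (pc c))))
        (≔-cong (λ s → reg c′ (20 + s)) (reg c) (same-reg sim) r v)
        (same-mem sim)
        (λ s s<20 → trans (≔-other (reg c′) (20 + r) v (low≢high s<20)) (kept sim s s<20))

    exec-simulated : ∀ coin instr {c c₁ c′} → Simulates θ c c′ → exec W coin instr c ≡ continue c₁ →
                     ∃[ c₁′ ] exec W′ coin (relocate instr) c′ ≡ continue c₁′ × Simulates θ c₁ c₁′
    exec-simulated coin (const r v) sim eq = setReg-simulated sim eq
    exec-simulated coin (arith op r s u) {c} sim eq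
      rewrite same-reg sim s | same-reg sim u with evalOp op (reg c s) (reg c u)
    ... | just v = setReg-simulated sim eq
    exec-simulated coin (load r s) {c} {c′ = c′} sim eq
      rewrite same-reg sim s | same-mem sim (reg c s) = setReg-simulated sim eq
    exec-simulated coin (store r s) {c} {c′ = c′} sim refl rewrite same-reg sim r | same-reg sim s =
      _ , refl , simulates
        (trans (cong suc (same-pc sim)) (sym (+-suc (length pre) (pc c))))
        (same-reg sim)
        (≔-cong (mem c′) (mem c) (same-mem sim) _ _)
        (kept sim)
    exec-simulated coin (jump ℓ) sim refl =
      _ , refl , simulates refl (same-reg sim) (same-mem sim) (kept sim)
    exec-simulated coin (jumpLess r s ℓ) {c} sim refl rewrite same-reg sim r | same-reg sim s
      with reg c r <ᵇ reg c s
    ... | true  = _ , refl , simulates refl (same-reg sim) (same-mem sim) (kept sim)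
    ... | false = _ , refl , simulates
        (trans (cong suc (same-pc sim)) (sym (+-suc (length pre) (pc c))))
        (same-reg sim) (same-mem sim) (kept sim)
    exec-simulated coin (flip r) sim eq = setReg-simulated sim eq

    setReg≢output : ∀ {c r v u} → setReg W c r v ≢ output u
    setReg≢output {v = v} eq with v <ᵇ W
    setReg≢output () | true
    setReg≢output () | false

    exec-exits : ∀ coin instr {c c′ v} → Simulates θ c c′ → exec W coin instr c ≡ output v →
                 ∃[ c₁′ ] exec W′ coin (relocate instr) c′ ≡ continue c₁′ × Exits θ v c₁′
    exec-exits coin halt sim refl = _ , refl , exits (same-reg sim 0) (kept sim)
    exec-exits coin (const r v) {c} sim eq = contradiction eq (setReg≢output {c} {r})
    exec-exits coin (arith op r s u) {c} sim eq with evalOp op (reg c s) (reg c u)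
    ... | just v = contradiction eq (setReg≢output {c} {r})
    exec-exits coin (load r s) {c} sim eq = contradiction eq (setReg≢output {c} {r})
    exec-exits coin (flip r) {c} sim eq = contradiction eq (setReg≢output {c} {r})

    -- Each instruction becomes exactly one instruction, so every step sees the same coin as in the
    -- original run. The callee may halt early; `finish` therefore has to cope with any supply of at
    -- least `T′` remaining coins.
    run-simulated : ∀ {c c′ v} → Simulates θ c c′ → (cs : Vec Bool τ) → run W P cs c ≡ just v →
                    ∀ {w} {T′} (es : Vec Bool T′) →
                    (∀ {T″ c″} (ds : Vec Bool T″) → T′ ≤ T″ → Exits θ v c″ → run W′ whole ds c″ ≡ just w) →
                    run W′ whole (cs Vec.++ es) c′ ≡ just w
    run-simulated {c = c} {c′} sim (b ∷ cs) eq {T′ = T′} es finish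
      rewrite same-pc sim
      with head (drop (pc c) P) in at
    ... | just instr
      rewrite fetch (pc c) at with exec W b instr c in ex
    ... | continue c₁ with exec-simulated b instr sim ex
    ...   | c₁′ , ex′ , sim₁ rewrite ex′ = run-simulated sim₁ cs eq es finish
    run-simulated {τ = suc τ} {c = c} {c′} sim (b ∷ cs) eq {T′ = T′} es finish | just instr | output v
      with exec-exits b instr sim ex
    ...   | c₁′ , ex′ , exiting rewrite ex′ =
      finish (cs Vec.++ es) (m≤n+m T′ τ) (subst (λ u → Exits _ u _) (just-injective eq) exiting)

-- Random coins

count : ∀ {n} {P : Vec Bool n → Set} → Decidable P → ℕ
count {n} P? = length (filter P? (bitVectors n))

length-filter-map : ∀ {A B : Set} {P : B → Set} (P? : Decidable P) (f : A → B) xs →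
                    length (filter P? (map f xs)) ≡ length (filter (P? ∘ f) xs)
length-filter-map P? f []       = refl
length-filter-map P? f (x ∷ xs) with does (P? (f x))
... | true  = cong suc (length-filter-map P? f xs)
... | false = length-filter-map P? f xs

count-suc : ∀ {n} {P : Vec Bool (suc n) → Set} (P? : Decidable P) →
            count P? ≡ count (P? ∘ (false ∷_)) + count (P? ∘ (true ∷_))
count-suc {n} P? = begin
  length (filter P? (map (false ∷_) (bitVectors n) ++ map (true ∷_) (bitVectors n)))
    ≡⟨ cong length (filter-++ P? (map (false ∷_) (bitVectors n)) _) ⟩
  length (filter P? (map (false ∷_) (bitVectors n)) ++ filter P? (map (true ∷_) (bitVectors n)))
    ≡⟨ length-++ (filter P? (map (false ∷_) (bitVectors n))) ⟩
  _ ≡⟨ cong₂ _+_ (length-filter-map P? (false ∷_) (bitVectors n))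
                 (length-filter-map P? (true ∷_) (bitVectors n)) ⟩
  _ ∎
  where open ≡-Reasoning

count-universal : ∀ {n} {P : Vec Bool n → Set} (P? : Decidable P) → (∀ cs → P cs) → 2 ^ n ≤ count P?
count-universal {zero} P? p with P? []
... | yes _ = ≤-refl
... | no ¬p = contradiction (p []) ¬p
count-universal {suc n} P? p rewrite count-suc P? = begin
  2 ^ n + (2 ^ n + 0)                                       ≡⟨ cong (2 ^ n +_) (+-identityʳ _) ⟩
  2 ^ n + 2 ^ n                                             ≤⟨ +-mono-≤ (count-universal _ (p ∘ (false ∷_))) (count-universal _ (p ∘ (true ∷_))) ⟩
  count (P? ∘ (false ∷_)) + count (P? ∘ (true ∷_))  ∎
  where open ≤-Reasoning

count-prefix : ∀ {n e} {P : Vec Bool n → Set} {Q : Vec Bool (n + e) → Set} (P? : Decidable P) (Q? : Decidable Q) →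
               (∀ cs es → P cs → Q (cs Vec.++ es)) → count P? * 2 ^ e ≤ count Q?
count-prefix {zero} {e} P? Q? P⇒Q with P? []
... | yes p = ≤-trans (≤-reflexive (+-identityʳ (2 ^ e))) (count-universal Q? (λ es → P⇒Q [] es p))
... | no ¬p = z≤n
count-prefix {suc n} {e} P? Q? P⇒Q rewrite count-suc P? | count-suc Q? = begin
  (count (P? ∘ (false ∷_)) + count (P? ∘ (true ∷_))) * 2 ^ e
    ≡⟨ *-distribʳ-+ (2 ^ e) (count (P? ∘ (false ∷_))) _ ⟩
  count (P? ∘ (false ∷_)) * 2 ^ e + count (P? ∘ (true ∷_)) * 2 ^ e
    ≤⟨ +-mono-≤ (count-prefix (P? ∘ (false ∷_)) _ (λ cs → P⇒Q (false ∷ cs)))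
                (count-prefix (P? ∘ (true ∷_)) _ (λ cs → P⇒Q (true ∷ cs))) ⟩
  count (Q? ∘ (false ∷_)) + count (Q? ∘ (true ∷_)) ∎
  where open ≤-Reasoning

count-framed : ∀ k {n e} {P : Vec Bool n → Set} {Q : Vec Bool (k + (n + e)) → Set}
               (P? : Decidable P) (Q? : Decidable Q) →
               (∀ (cs : Vec Bool k) (ds : Vec Bool n) (es : Vec Bool e) → P ds → Q (cs Vec.++ (ds Vec.++ es))) → 2 ^ k * (count P? * 2 ^ e) ≤ count Q?
count-framed zero    P? Q? P⇒Q = subst (_≤ count Q?) (sym (*-identityˡ _)) (count-prefix P? Q? (P⇒Q []))
count-framed (suc k) {e = e} P? Q? P⇒Q rewrite count-suc Q? = begin
  (2 ^ k + (2 ^ k + 0)) * (count P? * 2 ^ e)                         ≡⟨ double (2 ^ k) _ ⟩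
  2 ^ k * (count P? * 2 ^ e) + 2 ^ k * (count P? * 2 ^ e)
    ≤⟨ +-mono-≤ (count-framed k P? (Q? ∘ (false ∷_)) (λ cs → P⇒Q (false ∷ cs)))
                (count-framed k P? (Q? ∘ (true ∷_)) (λ cs → P⇒Q (true ∷ cs))) ⟩
  count (Q? ∘ (false ∷_)) + count (Q? ∘ (true ∷_))                   ∎
  where
  open ≤-Reasoning
  double : ∀ x y → (x + (x + 0)) * y ≡ x * y + x * y
  double = solve-∀

-- The `k` coins before and the `e` coins after the window multiply the number of all strings and
-- the guaranteed number of good ones by the same factor, so the probability 2/3 is preserved.
succeeds-framed : ∀ {m W W′ input input′ answer answer′} {P P′ : Program m} k T e →
  (∀ (cs : Vec Bool k) (ds : Vec Bool T) (es : Vec Bool e) → Correct W P input answer ds →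
     Correct W′ P′ input′ answer′ (cs Vec.++ (ds Vec.++ es))) →
  Succeeds W P input answer T → Succeeds W′ P′ input′ answer′ (k + (T + e))
succeeds-framed {deterministic} k T e lift correct coins with Vec.splitAt k coins
... | cs , rest , refl with Vec.splitAt T rest
...   | ds , es , refl = lift cs ds es (correct ds)
succeeds-framed {randomized} {W} {W′} {input} {input′} {answer} {answer′} {P} {P′} k T e lift likely = begin
  2 * 2 ^ (k + (T + e))             ≡⟨ cong (2 *_) (trans (^-distribˡ-+-* 2 k (T + e)) (cong (2 ^ k *_) (^-distribˡ-+-* 2 T e))) ⟩
  2 * (2 ^ k * (2 ^ T * 2 ^ e))     ≡⟨ regroup 2 (2 ^ k) (2 ^ T) (2 ^ e) ⟩
  2 ^ k * ((2 * 2 ^ T) * 2 ^ e)     ≤⟨ *-monoʳ-≤ (2 ^ k) (*-monoˡ-≤ (2 ^ e) likely) ⟩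
  2 ^ k * ((3 * count P?) * 2 ^ e)  ≡⟨ regroup 3 (2 ^ k) (count P?) (2 ^ e) ⟨
  3 * (2 ^ k * (count P? * 2 ^ e))  ≤⟨ *-monoʳ-≤ 3 (count-framed k P? Q? lift) ⟩
  3 * count Q?                      ∎
  where
  open ≤-Reasoning
  P? = correct? W P input answer
  Q? = correct? W′ P′ input′ answer′
  regroup : ∀ a x y z → a * (x * (y * z)) ≡ x * ((a * y) * z)
  regroup = solve-∀

-- The reduction as a RAM program

data Side : Set where
  weightsCoarse profitsCoarse : Side

choose : {A : Set} → Side → A → A → A
choose weightsCoarse x y = x
choose profitsCoarse x y = y

module Items (side : Side) (N : ℕ) (val : ℕ → ℕ) where

  -- Items 1, …, 4N − 1 stand for the entries of A, B and C, in this order, and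
  -- val lists these entries.  Up to terms whose sum stays below 16 N, an item
  -- has coarse value 6 · 16 N, 7 · 16 N or 10 · 16 N, according to its class; and
  -- (1, 1, 1) is the only solution of 6 x + 7 y + 10 z = 23 = 6 + 7 + 10.  The
  -- lower-order terms of items for A[i], B[j], C[k] sum up to 2 N + 1 + i + j − k,
  -- and their excesses to N + A[i] + B[j] − C[k].
  coarse excess fine weight profit : ℕ → ℕ
  coarse q = if N <ᵇ q then (if N + N <ᵇ q then N * 164 ∸ q else N * 111 + q) else N * 96 + q
  excess q = if N + N <ᵇ q then N ∸ val q else val q
  fine q   = choose side (coarse q * N ∸ excess q) (coarse q * N + excess q)
  weight q = choose side (coarse q) (fine q)
  profit q = choose side (fine q) (coarse q)

  -- `N * 370 + 1` is 23 · 16 N plus 2 N + 1, the lower-order total for i + j = k. The fine target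
  -- differs from the `N`-fold coarse one by `N ∸ 1`, the largest excess to be tolerated.
  coarseTarget fineTarget limit threshold : ℕ
  coarseTarget = N * 370 + 1
  fineTarget   = choose side (coarseTarget * N ∸ N + 1) (coarseTarget * N + N ∸ 1)
  limit        = choose side coarseTarget fineTarget
  threshold    = choose side fineTarget coarseTarget

capacityReg thresholdReg : Side → Reg
capacityReg  side = choose side 9 10
thresholdReg side = choose side 10 9

-- Entry q is read at address q, its weight goes to q + 1 and its profit to
-- 4N + q; doing this for q = 4N − 1, …, 1 overwrites no entry before it is read.
--
-- Instructions 0–17 are the setup, 18–20 the loop test and the exit, 21–29
-- distinguish the classes, and 30–37 write an item.  Registers: 1, 3, 4 hold N,
-- 2N, 4N; 5–7 the offsets of the classes; 8 the index q; 9 and 10 the coarse and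
-- the fine target; 15–17 the excess, coarse and fine value; 18 an address.
prologue : ∀ {m} → Side → Program m
prologue side =
  load 1 0 ∷ const 2 1 ∷ arith add 3 1 1 ∷ arith add 4 3 3 ∷ arith sub 8 4 2 ∷ store 0 8 ∷
  const 5 96 ∷ arith mul 5 1 5 ∷ const 6 111 ∷ arith mul 6 1 6 ∷ const 7 164 ∷ arith mul 7 1 7 ∷
  const 9 370 ∷ arith mul 9 1 9 ∷ arith add 9 9 2 ∷
  arith mul 10 9 1 ∷ arith (choose side sub add) 10 10 1 ∷ arith (choose side add sub) 10 10 2 ∷
  jumpLess 0 8 21 ∷ store 2 (capacityReg side) ∷ jump 38 ∷
  load 15 8 ∷ jumpLess 1 8 25 ∷ arith add 16 5 8 ∷ jump 30 ∷
  jumpLess 3 8 28 ∷ arith add 16 6 8 ∷ jump 30 ∷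
  arith sub 16 7 8 ∷ arith sub 15 1 15 ∷
  arith mul 17 16 1 ∷ arith (choose side sub add) 17 17 15 ∷
  arith add 18 8 2 ∷ store 18 (choose side 16 17) ∷
  arith add 18 4 8 ∷ store 18 (choose side 17 16) ∷
  arith sub 8 8 2 ∷ jump 18 ∷ []

evalOp-choose : ∀ side x y → evalOp (choose side sub add) x y ≡ just (choose side (x ∸ y) (x + y))
evalOp-choose weightsCoarse x y = refl
evalOp-choose profitsCoarse x y = refl

evalOp-choose-choose : ∀ side x x′ y →
  evalOp (choose side add sub) (choose side x x′) y ≡ just (choose side (x + y) (x′ ∸ y))
evalOp-choose-choose weightsCoarse x x′ y = refl
evalOp-choose-choose profitsCoarse x x′ y = refl

choose-≤ : ∀ side {x y b} → x ≤ b → y ≤ b → choose side x y ≤ b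
choose-≤ weightsCoarse x≤b y≤b = x≤b
choose-≤ profitsCoarse x≤b y≤b = y≤b

reg-choose : ∀ side (ρ : Reg → ℕ) r s {x y} → ρ r ≡ x → ρ s ≡ y → ρ (choose side r s) ≡ choose side x y
reg-choose weightsCoarse ρ r s eq _ = eq
reg-choose profitsCoarse ρ r s _ eq = eq

-- Ranges of the item values and correctness of the prologue

module ItemBounds (side : Side) (N : ℕ) (val : ℕ → ℕ)
  (val≤N : ∀ q → 0 < q → q < N + N + (N + N) → val q ≤ N) where

  open Items side N val

  coarse-≤ : ∀ q → q < (N + N + (N + N)) → coarse q ≤ N * 164
  coarse-≤ q q<4N with N <ᵇ q | N + N <ᵇ q
  ... | true  | true  = m∸n≤m _ q
  ... | true  | false = subst (N * 111 + q ≤_) (lemma N) (+-monoʳ-≤ (N * 111) (<⇒≤ (<-≤-trans q<4N (m≤m+n (N + N + (N + N)) (N * 49)))))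
    where
    lemma : ∀ n → n * 111 + (n + n + (n + n) + n * 49) ≡ n * 164
    lemma = solve-∀
  ... | false | _     = subst (N * 96 + q ≤_) (lemma N) (+-monoʳ-≤ (N * 96) (<⇒≤ (<-≤-trans q<4N (m≤m+n (N + N + (N + N)) (N * 64)))))
    where
    lemma : ∀ n → n * 96 + (n + n + (n + n) + n * 64) ≡ n * 164
    lemma = solve-∀

  coarse-≥ : ∀ q → q < N + N + (N + N) → N * 96 ≤ coarse q
  coarse-≥ q q<4N with N <ᵇ q | N + N <ᵇ q
  ... | true  | true  = m+n≤o⇒m≤o∸n (N * 96) (≤-trans (+-monoʳ-≤ (N * 96) (<⇒≤ (<-≤-trans q<4N (m≤m+n _ (N * 64)))))
                          (≤-reflexive (lemma N)))
    where
    lemma : ∀ n → n * 96 + (n + n + (n + n) + n * 64) ≡ n * 164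
    lemma = solve-∀
  ... | true  | false = ≤-trans (*-monoʳ-≤ N (m≤m+n 96 15)) (m≤m+n _ q)
  ... | false | _     = m≤m+n _ q

  excess-≤ : ∀ q → 0 < q → q < (N + N + (N + N)) → excess q ≤ N
  excess-≤ q q>0 q<4N with N + N <ᵇ q
  ... | true  = m∸n≤m N (val q)
  ... | false = val≤N q q>0 q<4N

module PrologueRun {m} (side : Side) (rest : Program m) (N W : ℕ) (N>0 : 0 < N)
  (wide : N * N * 1024 < W) (val : ℕ → ℕ) (val≤N : ∀ q → 0 < q → q < N + N + (N + N) → val q ≤ N) where

  open Items side N val
  open ItemBounds side N val val≤N

  private
    P : Program m
    P = prologue side ++ rest

    4N : ℕ
    4N = N + N + (N + N)

    N<4N : N < 4N
    N<4N = <-≤-trans (m<m+n N N>0) (m≤m+n (N + N) (N + N))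

    1≤4N : 1 ≤ 4N
    1≤4N = ≤-trans N>0 (<⇒≤ N<4N)

    4N∸1<4N : 4N ∸ 1 < 4N
    4N∸1<4N = ∸-monoʳ-< {4N} (s≤s z≤n) 1≤4N

    -- A record, since Agda would unfold N * N * c when solving for c.
    record _≲_ (x c : ℕ) : Set where
      constructor ⟪_⟫
      field bound : x ≤ N * N * c

    infix  4 _≲_
    infixl 6 _⊞_

    1≤N*N : 1 ≤ N * N
    1≤N*N = *-mono-≤ N>0 N>0

    N≤N*N : N ≤ N * N
    N≤N*N = m≤m*n N N {{>-nonZero N>0}}

    plain : ∀ c → c ≲ c
    plain c = ⟪ m≤n*m c (N * N) {{>-nonZero 1≤N*N}} ⟫

    linear : ∀ c → N * c ≲ c
    linear c = ⟪ *-monoˡ-≤ c N≤N*N ⟫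

    N≲ : N ≲ 1
    N≲ = ⟪ subst (N ≤_) (sym (*-identityʳ (N * N))) N≤N*N ⟫

    below : ∀ {x y c} → x ≤ y → y ≲ c → x ≲ c
    below x≤y ⟪ y≤ ⟫ = ⟪ ≤-trans x≤y y≤ ⟫

    _⊞_ : ∀ {x y c d} → x ≲ c → y ≲ d → x + y ≲ c + d
    _⊞_ {c = c} {d} ⟪ x≤ ⟫ ⟪ y≤ ⟫ =
      ⟪ ≤-trans (+-mono-≤ x≤ y≤) (≤-reflexive (sym (*-distribˡ-+ (N * N) c d))) ⟫

    -- Sizes are tracked as multiples of N², with the multiple in the type, so that the comparison
    -- with 1024 is settled by evaluation. The largest multiple that occurs is 373, for
    -- `fineTarget`.
    fits : ∀ {x c} {{_ : Bool.T (c ≤ᵇ 1024)}} → x ≲ c → x < W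
    fits {c = c} {{c≤}} ⟪ x≤ ⟫ = <-≤-trans (s≤s (≤-trans x≤ (*-monoʳ-≤ (N * N) (≤ᵇ⇒≤ c 1024 c≤)))) wide

    4N≲ : 4N ≲ 4
    4N≲ = N≲ ⊞ N≲ ⊞ (N≲ ⊞ N≲)

    coarse*N≲ : ∀ q → q < 4N → coarse q * N ≲ 164
    coarse*N≲ q q<4N = ⟪ ≤-trans (*-monoˡ-≤ N (coarse-≤ q q<4N)) (≤-reflexive (lemma N 164)) ⟫
      where
      lemma : ∀ n c → n * c * n ≡ n * n * c
      lemma = solve-∀

    target≲ : coarseTarget ≲ 371
    target≲ = linear 370 ⊞ plain 1

    target*N≲ : coarseTarget * N ≲ 371
    target*N≲ = ⟪ ≤-trans (*-monoˡ-≤ N (+-monoʳ-≤ (N * 370) N>0)) (≤-reflexive (lemma N 370)) ⟫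
      where
      lemma : ∀ n c → (n * c + n) * n ≡ n * n * (1 + c)
      lemma = solve-∀

  -- `isUp` provides the zero registers that the callee expects initially. Register 0 stays zero and
  -- serves as the constant of the loop test.
  record Registers (i : ℕ) (ρ : Reg → ℕ) : Set where
    field
      is0  : ρ 0 ≡ 0
      is1  : ρ 1 ≡ N
      is2  : ρ 2 ≡ 1
      is3  : ρ 3 ≡ N + N
      is4  : ρ 4 ≡ 4N
      is5  : ρ 5 ≡ N * 96
      is6  : ρ 6 ≡ N * 111
      is7  : ρ 7 ≡ N * 164
      is8  : ρ 8 ≡ i
      is9  : ρ 9 ≡ coarseTarget
      is10 : ρ 10 ≡ fineTarget
      isUp : ∀ r → ρ (20 + r) ≡ 0

  open Registers

  -- Registers 15 to 19 occur in no field of the invariant.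
  scratch : ∀ {i ρ} k {v} → k < 5 → Registers i ρ → Registers i (ρ [ 15 + k ≔ v ])
  scratch {ρ = ρ} k {v} k<5 R = record
    { is0 = is0 R ; is1 = is1 R ; is2 = is2 R ; is3 = is3 R ; is4 = is4 R ; is5 = is5 R ; is6 = is6 R
    ; is7 = is7 R ; is8 = is8 R ; is9 = is9 R ; is10 = is10 R
    ; isUp = λ r → trans (≔-other ρ (15 + k) v λ { refl → <⇒≱ k<5 (m≤m+n 5 r) }) (isUp R r) }

  -- Address i + 1 belongs to neither `unread` nor `weights`: its entry has been consumed, and the
  -- weight of item i (for i = 0, the capacity) is yet to be stored there. `beyond` records that the
  -- memory after the Knapsack input looks untouched.
  record Memory (i : ℕ) (μ : ℕ → ℕ) : Set where
    field
      items   : μ 0 ≡ 4N ∸ 1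
      unread  : ∀ q → 0 < q → q ≤ i → μ q ≡ val q
      weights : ∀ q → i < q → q < 4N → μ (q + 1) ≡ weight q
      profits : ∀ q → i < q → q < 4N → μ (4N + q) ≡ profit q
      beyond  : ∀ a → 4N + 4N ≤ a → μ a ≡ 0

  open Memory

  -- Address i + 2 lies above all unread entries and below the weights stored so far; 4N + i + 1
  -- lies above all weights and below the profits stored so far; both lie below 8N.
  fill : ∀ {i μ} → suc i < 4N → Memory (suc i) μ →
         Memory i ((μ [ suc i + 1 ≔ weight (suc i) ]) [ 4N + suc i ≔ profit (suc i) ])
  fill {i} {μ} i<4N M = record
    { items   = trans (elsewhere (λ ()) (<⇒≢ (<-≤-trans (s≤s z≤n) (m≤n+m (suc i) 4N)))) (items M)
    ; unread  = λ q q>0 q≤i → trans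
        (elsewhere (<⇒≢ (s≤s (≤-trans q≤i (m≤m+n i 1)))) (<⇒≢ (≤-<-trans q≤i (<-≤-trans (n<1+n i) (m≤n+m (suc i) 4N)))))
        (unread M q q>0 (m≤n⇒m≤1+n q≤i))
    ; weights = w
    ; profits = p
    ; beyond  = λ a a≥8N → trans
        (elsewhere (>⇒≢ (<-≤-trans (≤-<-trans (+-monoʳ-≤ (suc i) N>0) (+-mono-< i<4N N<4N)) a≥8N))
                   (>⇒≢ (<-≤-trans (+-monoʳ-< 4N i<4N) a≥8N)))
        (beyond M a a≥8N)
    }
    where
    μ₁ = μ [ suc i + 1 ≔ weight (suc i) ]
    elsewhere : ∀ {a} → a ≢ suc i + 1 → a ≢ 4N + suc i → (μ₁ [ 4N + suc i ≔ profit (suc i) ]) a ≡ μ a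
    elsewhere a≢₁ a≢₂ = trans (≔-other μ₁ _ _ a≢₂) (≔-other μ _ _ a≢₁)
    q+1<4N+ : ∀ {q} → q < 4N → q + 1 < 4N + suc i
    q+1<4N+ q<4N = +-mono-<-≤ q<4N (s≤s z≤n)
    w : ∀ q → i < q → q < 4N → (μ₁ [ 4N + suc i ≔ profit (suc i) ]) (q + 1) ≡ weight q
    w q i<q q<4N with m≤n⇒m<n∨m≡n i<q
    ... | inj₁ 1+i<q = trans (elsewhere (λ eq → <⇒≢ 1+i<q (sym (+-cancelʳ-≡ 1 q (suc i) eq)))
                                        (<⇒≢ (q+1<4N+ q<4N))) (weights M q 1+i<q q<4N)
    ... | inj₂ refl  = trans (≔-other μ₁ _ _ (<⇒≢ (q+1<4N+ q<4N))) (≔-same μ (suc i + 1) _)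
    p : ∀ q → i < q → q < 4N → (μ₁ [ 4N + suc i ≔ profit (suc i) ]) (4N + q) ≡ profit q
    p q i<q q<4N with m≤n⇒m<n∨m≡n i<q
    ... | inj₁ 1+i<q = trans (elsewhere (>⇒≢ (<-≤-trans (+-monoʳ-< (suc i) {x = 1} {y = 4N} (≤-<-trans N>0 N<4N))
                                                   (subst (_≤ 4N + q) (+-comm 4N (suc i)) (+-monoʳ-≤ 4N i<q))))
                                        (λ eq → <⇒≢ 1+i<q (sym (+-cancelˡ-≡ 4N q (suc i) eq))))
                             (profits M q 1+i<q q<4N)
    ... | inj₂ refl  = ≔-same μ₁ (4N + suc i) _

  Reaches : ℕ → Config → (Config → Set) → Set
  Reaches b c Q = ∃[ k ] k ≤ b × ∃[ c′ ] Steps W P c k c′ × Q c′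

  item-tail : ∀ {i ρ μ} → suc i < 4N → Registers (suc i) ρ →
              ρ 15 ≡ excess (suc i) → ρ 16 ≡ coarse (suc i) →
              ∃[ ρ′ ] Steps W P ⟨ 30 , ρ , μ ⟩ 8
                ⟨ 18 , ρ′ , (μ [ suc i + 1 ≔ weight (suc i) ]) [ 4N + suc i ≔ profit (suc i) ] ⟩ ×
              Registers i ρ′
  item-tail {i} {ρ} {μ} i<4N R is15 is16 = _ ,
    ( step-arith P refl is16 (is1 R) refl (fits c*N≲)
    then step-arith P refl refl is15 (evalOp-choose side _ _) (fits fine≲)
    then step-arith P refl (is8 R) (is2 R) refl (fits (i≲ ⊞ plain 1))
    then step-store P refl refl (reg-choose side ρ₁ 16 17 is16 refl)
    then step-arith P refl (is4 R) (is8 R) refl (fits (4N≲ ⊞ i≲))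
    then step-store P refl refl (reg-choose side ρ₂ 17 16 refl is16)
    then step-arith P refl (is8 R) (is2 R) refl (fits (below (n≤1+n i) i≲))
    then step-jump P refl
    then done ) ,
    record { is0 = is0 R ; is1 = is1 R ; is2 = is2 R ; is3 = is3 R ; is4 = is4 R ; is5 = is5 R ; is6 = is6 R
           ; is7 = is7 R ; is8 = refl ; is9 = is9 R ; is10 = is10 R ; isUp = isUp R }
    where
    ρ₁ = ((ρ [ 17 ≔ coarse (suc i) * N ]) [ 17 ≔ fine (suc i) ]) [ 18 ≔ suc i + 1 ]
    ρ₂ = ρ₁ [ 18 ≔ 4N + suc i ]
    c*N≲ = coarse*N≲ (suc i) i<4N
    e≲ : excess (suc i) ≲ 1
    e≲ = below (excess-≤ (suc i) (s≤s z≤n) i<4N) N≲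
    fine≲ : fine (suc i) ≲ 165
    fine≲ = below (choose-≤ side (≤-trans (m∸n≤m _ (excess (suc i))) (m≤m+n _ _)) ≤-refl) (c*N≲ ⊞ e≲)
    i≲ : suc i ≲ 4
    i≲ = below (<⇒≤ i<4N) 4N≲

  item : ∀ {i ρ μ} → suc i < 4N → Registers (suc i) ρ → μ (suc i) ≡ val (suc i) →
         Reaches 14 ⟨ 18 , ρ , μ ⟩ λ c′ →
           pc c′ ≡ 18 × Registers i (reg c′) ×
           mem c′ ≡ (μ [ suc i + 1 ≔ weight (suc i) ]) [ 4N + suc i ≔ profit (suc i) ]
  item {i} {ρ} {μ} i<4N R μ≡val = go
    where
    i≲ : suc i ≲ 4
    i≲ = below (<⇒≤ i<4N) 4N≲
    v≲ : val (suc i) ≲ 1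
    v≲ = below (val≤N (suc i) (s≤s z≤n) i<4N) N≲
    ρ₁ = ρ [ 15 ≔ val (suc i) ]
    R₁ : Registers (suc i) ρ₁
    R₁ = scratch 0 (s≤s z≤n) R
    enter : Steps W P ⟨ 18 , ρ , μ ⟩ 2 ⟨ 22 , ρ₁ , μ ⟩
    enter = step-less P refl (is0 R) (is8 R) (s≤s z≤n)
       then step-load P refl (is8 R) μ≡val (fits v≲)
       then done
    go : Reaches 14 ⟨ 18 , ρ , μ ⟩ λ c′ →
           pc c′ ≡ 18 × Registers i (reg c′) ×
           mem c′ ≡ (μ [ suc i + 1 ≔ weight (suc i) ]) [ 4N + suc i ≔ profit (suc i) ]
    go with suc i ≤? N
    ... | yes i≤N =
      let ρ′ , steps , R′ = item-tail i<4N (scratch 1 (s≤s (s≤s z≤n)) R₁) (sym excess≡) (sym coarse≡)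
      in 13 , n≤1+n 13 , _ ,
         ( enter followed-by step-notLess P refl (is1 R) (is8 R) i≤N
           then step-arith P refl (is5 R) (is8 R) refl (fits (linear 96 ⊞ i≲))
           then step-jump P refl
           then steps ) , refl , R′ , refl
      where
      coarse≡ : coarse (suc i) ≡ N * 96 + suc i
      coarse≡ rewrite <ᵇ-false i≤N = refl
      excess≡ : excess (suc i) ≡ val (suc i)
      excess≡ rewrite <ᵇ-false (≤-trans i≤N (m≤m+n N N)) = refl
    ... | no i≰N with suc i ≤? N + N
    ...   | yes i≤2N =
      let ρ′ , steps , R′ = item-tail i<4N (scratch 1 (s≤s (s≤s z≤n)) R₁) (sym excess≡) (sym coarse≡)
      in 14 , ≤-refl , _ ,
         ( enter followed-by step-less P refl (is1 R) (is8 R) (≰⇒> i≰N)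
           then step-notLess P refl (is3 R) (is8 R) i≤2N
           then step-arith P refl (is6 R) (is8 R) refl (fits (linear 111 ⊞ i≲))
           then step-jump P refl
           then steps ) , refl , R′ , refl
      where
      coarse≡ : coarse (suc i) ≡ N * 111 + suc i
      coarse≡ rewrite <ᵇ-true (≰⇒> i≰N) | <ᵇ-false i≤2N = refl
      excess≡ : excess (suc i) ≡ val (suc i)
      excess≡ rewrite <ᵇ-false i≤2N = refl
    ...   | no i≰2N =
      let ρ′ , steps , R′ = item-tail i<4N (scratch 0 (s≤s z≤n) (scratch 1 (s≤s (s≤s z≤n)) R₁))
            (sym excess≡) (sym coarse≡)
      in 14 , ≤-refl , _ ,
         ( enter followed-by step-less P refl (is1 R) (is8 R) (≰⇒> i≰N)
           then step-less P refl (is3 R) (is8 R) (≰⇒> i≰2N)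
           then step-arith P refl (is7 R) (is8 R) refl (fits (below (m∸n≤m _ (suc i)) (linear 164)))
           then step-arith P refl (is1 R) refl refl (fits (below (m∸n≤m _ (val (suc i))) N≲))
           then steps ) , refl , R′ , refl
      where
      coarse≡ : coarse (suc i) ≡ N * 164 ∸ suc i
      coarse≡ rewrite <ᵇ-true (≰⇒> i≰N) | <ᵇ-true (≰⇒> i≰2N) = refl
      excess≡ : excess (suc i) ≡ N ∸ val (suc i)
      excess≡ rewrite <ᵇ-true (≰⇒> i≰2N) = refl

  loop : ∀ i {ρ μ} → i < 4N → Registers i ρ → Memory i μ →
         Reaches (i * 14) ⟨ 18 , ρ , μ ⟩ λ c′ → pc c′ ≡ 18 × Registers 0 (reg c′) × Memory 0 (mem c′)
  loop zero    i<4N R M = 0 , z≤n , _ , done , refl , R , M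
  loop (suc i) i<4N R M with item i<4N R (unread M (suc i) (s≤s z≤n) ≤-refl)
  ... | k , k≤ , ⟨ _ , _ , _ ⟩ , steps , refl , R′ , refl
    with loop i (<-trans (n<1+n i) i<4N) R′ (fill i<4N M)
  ...   | l , l≤ , c″ , steps′ , final =
    k + l , +-mono-≤ k≤ l≤ , c″ , (steps followed-by steps′) , final

  setup : ∀ {μ} → μ 0 ≡ N → (∀ q → 0 < q → q < 4N → μ q ≡ val q) → (∀ a → 4N ≤ a → μ a ≡ 0) →
          ∃[ ρ ] Steps W P ⟨ 0 , (λ _ → 0) , μ ⟩ 18 ⟨ 18 , ρ , μ [ 0 ≔ 4N ∸ 1 ] ⟩ ×
          Registers (4N ∸ 1) ρ × Memory (4N ∸ 1) (μ [ 0 ≔ 4N ∸ 1 ])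
  setup {μ} length≡ entries outside = _ ,
    ( step-load P refl (refl {x = 0}) length≡ (fits N≲)
    then step-const P refl (fits (plain 1))
    then step-arith P refl (refl {x = N}) (refl {x = N}) refl (fits (N≲ ⊞ N≲))
    then step-arith P refl (refl {x = N + N}) (refl {x = N + N}) refl (fits 4N≲)
    then step-arith P refl (refl {x = 4N}) (refl {x = 1}) refl (fits (below (m∸n≤m 4N 1) 4N≲))
    then step-store P refl (refl {x = 0}) (refl {x = 4N ∸ 1})
    then step-const P refl (fits (plain 96))
    then step-arith P refl (refl {x = N}) (refl {x = 96}) refl (fits (linear 96))
    then step-const P refl (fits (plain 111))
    then step-arith P refl (refl {x = N}) (refl {x = 111}) refl (fits (linear 111))
    then step-const P refl (fits (plain 164))
    then step-arith P refl (refl {x = N}) (refl {x = 164}) refl (fits (linear 164))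
    then step-const P refl (fits (plain 370))
    then step-arith P refl (refl {x = N}) (refl {x = 370}) refl (fits (linear 370))
    then step-arith P refl (refl {x = N * 370}) (refl {x = 1}) refl (fits target≲)
    then step-arith P refl (refl {x = coarseTarget}) (refl {x = N}) refl (fits target*N≲)
    then step-arith P refl (refl {x = coarseTarget * N}) (refl {x = N}) (evalOp-choose side _ _) (fits shifted≲)
    then step-arith P refl (refl {x = shifted}) (refl {x = 1}) (evalOp-choose-choose side _ _ _) (fits fineTarget≲)
    then done ) ,
    record { is0 = refl ; is1 = refl ; is2 = refl ; is3 = refl ; is4 = refl ; is5 = refl ; is6 = refl
           ; is7 = refl ; is8 = refl ; is9 = refl ; is10 = refl ; isUp = λ _ → refl } ,
    record
      { items   = refl
      ; unread  = λ { q@(suc _) q>0 q≤ → entries q q>0 (≤-<-trans q≤ 4N∸1<4N) }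
      ; weights = λ q q> q<4N → contradiction (∸-monoˡ-≤ 1 q<4N) (<⇒≱ q>)
      ; profits = λ q q> q<4N → contradiction (∸-monoˡ-≤ 1 q<4N) (<⇒≱ q>)
      ; beyond  = λ a a≥ → trans (≔-other μ 0 (4N ∸ 1) (>⇒≢ (≤-trans 1≤4N (≤-trans (m≤m+n 4N 4N) a≥))))
                                 (outside a (≤-trans (m≤m+n 4N 4N) a≥)) }
    where
    shifted = choose side (coarseTarget * N ∸ N) (coarseTarget * N + N)
    shifted≲ : shifted ≲ 372
    shifted≲ = below (choose-≤ side (≤-trans (m∸n≤m _ N) (m≤m+n _ _)) ≤-refl) (target*N≲ ⊞ N≲)
    fineTarget≲ : fineTarget ≲ 373
    fineTarget≲ = below
      (choose-≤ side (+-monoˡ-≤ 1 (≤-trans (m∸n≤m (coarseTarget * N) N) (m≤m+n _ N)))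
                     (≤-trans (m∸n≤m _ 1) (m≤m+n _ 1)))
      (target*N≲ ⊞ N≲ ⊞ plain 1)

  record Prepared (c : Config) : Set where
    field
      at-38      : pc c ≡ 38
      cleared    : ∀ r → reg c (20 + r) ≡ 0
      threshold′ : reg c (thresholdReg side) ≡ threshold
      mem-size   : mem c 0 ≡ 4N ∸ 1
      mem-limit  : mem c 1 ≡ limit
      mem-weight : ∀ q → 0 < q → q < 4N → mem c (q + 1) ≡ weight q
      mem-profit : ∀ q → 0 < q → q < 4N → mem c (4N + q) ≡ profit q
      mem-beyond : ∀ a → 4N + 4N ≤ a → mem c a ≡ 0

  leave : ∀ {ρ μ} → Registers 0 ρ →
          Steps W P ⟨ 18 , ρ , μ ⟩ 3 ⟨ 38 , ρ , μ [ 1 ≔ limit ] ⟩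
  leave {ρ} R = step-notLess P refl (is0 R) (is8 R) z≤n
    then step-store P refl (is2 R) (reg-choose side ρ 9 10 (is9 R) (is10 R))
    then step-jump P refl
    then done

  prepared : ∀ {ρ μ} → Registers 0 ρ → Memory 0 μ → Prepared ⟨ 38 , ρ , μ [ 1 ≔ limit ] ⟩
  prepared {ρ} {μ} R M = record
    { at-38      = refl
    ; cleared    = isUp R
    ; threshold′ = reg-choose side ρ 10 9 (is10 R) (is9 R)
    ; mem-size   = items M
    ; mem-limit  = refl
    ; mem-weight = λ q q>0 q<4N → trans (≔-other μ 1 limit (>⇒≢ (+-monoˡ-≤ 1 q>0))) (weights M q q>0 q<4N)
    ; mem-profit = λ q q>0 q<4N → trans (≔-other μ 1 limit (>⇒≢ (+-mono-≤ 1≤4N q>0))) (profits M q q>0 q<4N)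
    ; mem-beyond = λ a a≥ → trans (≔-other μ 1 limit (>⇒≢ (≤-trans (+-mono-≤ 1≤4N 1≤4N) a≥))) (beyond M a a≥)
    }

  prepare : ∀ {μ} → μ 0 ≡ N → (∀ q → 0 < q → q < 4N → μ q ≡ val q) → (∀ a → 4N ≤ a → μ a ≡ 0) →
            Reaches (18 + (4N * 14 + 3)) ⟨ 0 , (λ _ → 0) , μ ⟩ Prepared
  prepare length≡ entries outside =
    let _ , steps , R , M                                 = setup length≡ entries outside
        k , k≤ , ⟨ _ , ρ , μ ⟩ , steps′ , at-18 , R′ , M′ = loop (4N ∸ 1) 4N∸1<4N R M
        k≤′ = ≤-trans k≤ (*-monoˡ-≤ 14 (m∸n≤m 4N 1))
        leave′ = subst (λ pc → Steps W P ⟨ pc , ρ , μ ⟩ 3 ⟨ 38 , ρ , μ [ 1 ≔ limit ] ⟩) (sym at-18) (leave R′)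
    in 18 + (k + 3) , +-monoʳ-≤ 18 (+-monoˡ-≤ 3 k≤′) , _ ,
       (steps followed-by (steps′ followed-by leave′)) , prepared R′ M′

-- Memory contents

entry : List ℕ → ℕ → ℕ
entry l = mem (initial l)

entry-[] : ∀ i → entry [] i ≡ 0
entry-[] zero    = refl
entry-[] (suc i) = refl

entry-++ˡ : ∀ {n} (v : Vec ℕ n) l i → entry (toList v ++ l) (toℕ i) ≡ lookup v i
entry-++ˡ (x ∷ v) l zero    = refl
entry-++ˡ (x ∷ v) l (suc i) = entry-++ˡ v l i

entry-++ʳ : ∀ {n} (v : Vec ℕ n) l i → entry (toList v ++ l) (n + i) ≡ entry l i
entry-++ʳ []      l i = refl
entry-++ʳ (x ∷ v) l i = entry-++ʳ v l i

entry-tabulate-++ˡ : ∀ {n} (f : ℕ → ℕ) l i → i < n → entry (toList (tabulate {n = n} (f ∘ toℕ)) ++ l) i ≡ f i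
entry-tabulate-++ˡ f l i i<n = begin
  entry (toList (tabulate (f ∘ toℕ)) ++ l) i                     ≡⟨ cong (entry (toList (tabulate (f ∘ toℕ)) ++ l)) (sym (toℕ-fromℕ< i<n)) ⟩
  entry (toList (tabulate (f ∘ toℕ)) ++ l) (toℕ (fromℕ< i<n))  ≡⟨ entry-++ˡ (tabulate (f ∘ toℕ)) l (fromℕ< i<n) ⟩
  lookup (tabulate (f ∘ toℕ)) (fromℕ< i<n)                       ≡⟨ lookup∘tabulate (f ∘ toℕ) (fromℕ< i<n) ⟩
  f (toℕ (fromℕ< i<n))                                           ≡⟨ cong f (toℕ-fromℕ< i<n) ⟩
  f i                                                              ∎
  where open ≡-Reasoning

data Split (m n i : ℕ) : Set where
  before : i < m → Split m n i
  within : ∀ j → j < n → i ≡ m + j → Split m n i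
  after  : ∀ j → i ≡ m + (n + j) → Split m n i

split : ∀ m n i → Split m n i
split m n i with i <? m
... | yes i<m = before i<m
... | no i≮m with m≤n⇒∃[o]m+o≡n (≮⇒≥ i≮m)
...   | j , refl with j <? n
...     | yes j<n = within j j<n refl
...     | no j≮n with m≤n⇒∃[o]m+o≡n (≮⇒≥ j≮n)
...       | l , refl = after l refl

-- Initial memory reads zero past the end of the input, so agreement at every address also requires
-- zeros after both blocks.
entries-tabulate : ∀ {n} (f g : ℕ → ℕ) {μ : ℕ → ℕ} →
  (∀ i → i < n → μ i ≡ f i) → (∀ i → i < n → μ (n + i) ≡ g i) → (∀ i → μ (n + (n + i)) ≡ 0) →
  ∀ i → μ i ≡ entry (toList (tabulate {n = n} (f ∘ toℕ)) ++ toList (tabulate {n = n} (g ∘ toℕ))) i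
entries-tabulate {n} f g {μ} μ≡f μ≡g μ≡0 i with split n n i
... | before i<n        = trans (μ≡f i i<n) (sym (entry-tabulate-++ˡ f _ i i<n))
... | within j j<n refl = trans (μ≡g j j<n) (sym (begin
    entry (toList fs ++ toList gs) (n + j)  ≡⟨ entry-++ʳ fs (toList gs) j ⟩
    entry (toList gs) j                     ≡⟨ cong (λ l → entry l j) (++-identityʳ (toList gs)) ⟨
    entry (toList gs ++ []) j               ≡⟨ entry-tabulate-++ˡ g [] j j<n ⟩
    g j                                     ∎))
  where
  open ≡-Reasoning
  fs gs : Vec ℕ n
  fs = tabulate (f ∘ toℕ)
  gs = tabulate (g ∘ toℕ)
... | after j refl      = trans (μ≡0 j) (sym (begin
    entry (toList fs ++ toList gs) (n + (n + j))  ≡⟨ entry-++ʳ fs (toList gs) (n + j) ⟩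
    entry (toList gs) (n + j)                     ≡⟨ cong (λ l → entry l (n + j)) (++-identityʳ (toList gs)) ⟨
    entry (toList gs ++ []) (n + j)               ≡⟨ entry-++ʳ gs [] j ⟩
    entry [] j                                    ≡⟨ entry-[] j ⟩
    0                                             ∎))
  where
  open ≡-Reasoning
  fs gs : Vec ℕ n
  fs = tabulate (f ∘ toℕ)
  gs = tabulate (g ∘ toℕ)

module Source (x : ConvolutionInstance) where
  open ConvolutionInstance x renaming (n to N; n>0 to N>0) public

  a b : Fin N → ℕ
  a i = toℕ (lookup A i)
  b j = toℕ (lookup B j)
  c : Fin (2 * N ∸ 1) → ℕ
  c k = toℕ (lookup C k)

  items : ℕ
  items = N + (N + (2 * N ∸ 1))

  1+items : suc items ≡ N + N + (N + N)
  1+items = begin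
    suc (N + (N + (2 * N ∸ 1)))     ≡⟨ shift N (2 * N ∸ 1) ⟩
    N + N + (1 + (2 * N ∸ 1))       ≡⟨ cong (N + N +_) (m+[n∸m]≡n (≤-trans N>0 (m≤m+n N (N + 0)))) ⟩
    N + N + (N + (N + 0))             ≡⟨ cong (λ z → N + N + (N + z)) (+-identityʳ N) ⟩
    N + N + (N + N)                   ∎
    where
    open ≡-Reasoning
    shift : ∀ n z → 1 + (n + (n + z)) ≡ n + n + (1 + z)
    shift = solve-∀

  sequences : List ℕ
  sequences = Problem.input BoundedMinPlusVerification x

  val : ℕ → ℕ
  val = entry sequences

  private
    as = Vec.map toℕ A
    bs = Vec.map toℕ B
    cs = Vec.map toℕ C

    -- With the trailing `[]` the last block can be read by `entry-++ˡ` like the other two.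
    values : List ℕ
    values = toList as ++ (toList bs ++ (toList cs ++ []))

    sequences≡ : sequences ≡ N ∷ values
    sequences≡ = cong (N ∷_) (begin
      map toℕ (toList A ++ toList B ++ toList C)
        ≡⟨ map-++ toℕ (toList A) _ ⟩
      map toℕ (toList A) ++ map toℕ (toList B ++ toList C)
        ≡⟨ cong (map toℕ (toList A) ++_) (map-++ toℕ (toList B) _) ⟩
      map toℕ (toList A) ++ (map toℕ (toList B) ++ map toℕ (toList C))
        ≡⟨ cong₂ _++_ (sym (toList-map toℕ A)) (cong₂ _++_ (sym (toList-map toℕ B))
             (trans (sym (toList-map toℕ C)) (sym (++-identityʳ _)))) ⟩
      values ∎)
      where
      open ≡-Reasoning

    val≡ : ∀ i → val i ≡ entry (N ∷ values) i
    val≡ i = cong (λ l → entry l i) sequences≡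

  val-a : ∀ i → val (suc (toℕ i)) ≡ a i
  val-a i = trans (val≡ (suc (toℕ i))) (trans (entry-++ˡ as _ i) (lookup-map i toℕ A))

  val-b : ∀ j → val (suc (N + toℕ j)) ≡ b j
  val-b j = trans (val≡ (suc (N + toℕ j))) (trans (entry-++ʳ as (toList bs ++ (toList cs ++ [])) (toℕ j)) (trans (entry-++ˡ bs (toList cs ++ []) j) (lookup-map j toℕ B)))

  val-c : ∀ k → val (suc (N + (N + toℕ k))) ≡ c k
  val-c k = trans (val≡ (suc (N + (N + toℕ k)))) (trans (entry-++ʳ as (toList bs ++ (toList cs ++ [])) (N + toℕ k)) (trans (entry-++ʳ bs (toList cs ++ []) (toℕ k))
              (trans (entry-++ˡ cs [] k) (lookup-map k toℕ C))))

  val-beyond : ∀ q → N + N + (N + N) ≤ q → val q ≡ 0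
  val-beyond q 4N≤q with m≤n⇒∃[o]m+o≡n 4N≤q
  ... | j , refl = trans (val≡ (N + N + (N + N) + j)) (trans (cong (entry (N ∷ values)) position)
      (trans (entry-++ʳ as (toList bs ++ (toList cs ++ [])) (N + (2 * N ∸ 1 + j))) (trans (entry-++ʳ bs (toList cs ++ []) (2 * N ∸ 1 + j)) (trans (entry-++ʳ cs [] j) (entry-[] j)))))
    where
    assoc : ∀ x y z → x + (x + y) + z ≡ x + (x + (y + z))
    assoc = solve-∀
    position : N + N + (N + N) + j ≡ suc (N + (N + (2 * N ∸ 1 + j)))
    position = trans (cong (_+ j) (sym 1+items)) (cong suc (assoc N (2 * N ∸ 1) j))

  val≤N : ∀ q → 0 < q → q < N + N + (N + N) → val q ≤ N
  val≤N (suc q) _ q< with split N N q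
  ... | before q<N = subst (_≤ N) (trans (sym (val-a i)) (cong (val ∘ suc) (toℕ-fromℕ< q<N))) (toℕ≤pred[n] (lookup A i))
    where i = fromℕ< q<N
  ... | within j j<N refl =
    subst (_≤ N) (trans (sym (val-b (fromℕ< j<N))) (cong (λ z → val (suc (N + z))) (toℕ-fromℕ< j<N)))
      (toℕ≤pred[n] (lookup B (fromℕ< j<N)))
  ... | after k refl =
    subst (_≤ N) (trans (sym (val-c (fromℕ< k<))) (cong (λ z → val (suc (N + (N + z)))) (toℕ-fromℕ< k<)))
      (toℕ≤pred[n] (lookup C (fromℕ< k<)))
    where
    k< : k < 2 * N ∸ 1
    k< = +-cancelˡ-< N _ _ (+-cancelˡ-< N _ _ (s<s⁻¹ (subst (suc (N + (N + k)) <_) (sym 1+items) q<)))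

-- Subset sums

∑ : ∀ {n} → (Fin n → ℕ) → Vec Bool n → ℕ
∑ f s = dot (tabulate f) s

∑-cong : ∀ {n} {f g : Fin n → ℕ} → f ≗ g → ∀ s → ∑ f s ≡ ∑ g s
∑-cong f≗g []      = refl
∑-cong f≗g (b ∷ s) = cong₂ _+_ (cong (_* bit b) (f≗g zero)) (∑-cong (f≗g ∘ suc) s)

∑-mono : ∀ {n} {f g : Fin n → ℕ} → (∀ i → f i ≤ g i) → ∀ s → ∑ f s ≤ ∑ g s
∑-mono f≤g []      = z≤n
∑-mono f≤g (b ∷ s) = +-mono-≤ (*-monoˡ-≤ (bit b) (f≤g zero)) (∑-mono (f≤g ∘ suc) s)

∑-+ : ∀ {n} (f g : Fin n → ℕ) s → ∑ (λ i → f i + g i) s ≡ ∑ f s + ∑ g s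
∑-+ f g []      = refl
∑-+ f g (b ∷ s) = trans (cong ((f zero + g zero) * bit b +_) (∑-+ (f ∘ suc) (g ∘ suc) s))
                        (regroup (f zero) (g zero) (bit b) (∑ (f ∘ suc) s) (∑ (g ∘ suc) s))
  where
  regroup : ∀ x y z u v → (x + y) * z + (u + v) ≡ (x * z + u) + (y * z + v)
  regroup = solve-∀

∑-* : ∀ {n} (f : Fin n → ℕ) c s → ∑ (λ i → f i * c) s ≡ ∑ f s * c
∑-* f c []      = refl
∑-* f c (b ∷ s) = trans (cong (f zero * c * bit b +_) (∑-* (f ∘ suc) c s))
                        (regroup (f zero) c (bit b) (∑ (f ∘ suc) s))
  where
  regroup : ∀ x c z u → x * c * z + u * c ≡ (x * z + u) * c
  regroup = solve-∀

∑-∸ : ∀ {n} (f g : Fin n → ℕ) → (∀ i → g i ≤ f i) → ∀ s → ∑ (λ i → f i ∸ g i) s + ∑ g s ≡ ∑ f s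
∑-∸ f g g≤f s = trans (sym (∑-+ (λ i → f i ∸ g i) g s)) (∑-cong (λ i → m∸n+n≡m (g≤f i)) s)

∑-++ : ∀ {m n} (f : Fin (m + n) → ℕ) (s : Vec Bool m) (t : Vec Bool n) →
       ∑ f (s Vec.++ t) ≡ ∑ (f ∘ (_↑ˡ n)) s + ∑ (f ∘ (m ↑ʳ_)) t
∑-++ f []      t = refl
∑-++ f (b ∷ s) t = trans (cong (f zero * bit b +_) (∑-++ (f ∘ suc) s t)) (sym (+-assoc (f zero * bit b) _ _))

∣_∣ₛ : ∀ {n} → Vec Bool n → ℕ
∣ s ∣ₛ = ∑ (λ _ → 1) s

∑-const-+ : ∀ {n} c (f : Fin n → ℕ) s → ∑ (λ i → c + f i) s ≡ ∣ s ∣ₛ * c + ∑ f s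
∑-const-+ c f s = trans (∑-+ (λ _ → c) f s) (cong (_+ ∑ f s)
  (trans (∑-cong (λ _ → sym (*-identityˡ c)) s) (∑-* (λ _ → 1) c s)))

∑-≤ : ∀ {n} c (f : Fin n → ℕ) → (∀ i → f i ≤ c) → ∀ s → ∑ f s ≤ ∣ s ∣ₛ * c
∑-≤ c f f≤c s = ≤-trans (∑-mono f≤c s) (≤-reflexive
  (trans (∑-cong (λ _ → sym (*-identityˡ c)) s) (∑-* (λ _ → 1) c s)))

∅ : ∀ {n} → ∃[ s ] ∀ (f : Fin n → ℕ) → ∑ f s ≡ 0
∅ {zero}  = [] , λ _ → refl
∅ {suc n} = let s , s≡0 = ∅ {n} in false ∷ s , λ f → cong₂ _+_ (*-zeroʳ (f zero)) (s≡0 (f ∘ suc))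

-- Stating the effect on every `f` lets one witness serve both coarse values and excesses, with no
-- description of its bits.
singleton : ∀ {n} (i : Fin n) → ∃[ s ] ∀ f → ∑ f s ≡ f i
singleton zero    = let s , s≡0 = ∅ in true ∷ s , λ f →
  trans (cong₂ _+_ (*-identityʳ (f zero)) (s≡0 (f ∘ suc))) (+-identityʳ (f zero))
singleton (suc i) = let s , s≡i = singleton i in false ∷ s , λ f → cong₂ _+_ (*-zeroʳ (f zero)) (s≡i (f ∘ suc))

∣s∣≡0⇒∑≡0 : ∀ {n} (s : Vec Bool n) → ∣ s ∣ₛ ≡ 0 → ∀ f → ∑ f s ≡ 0
∣s∣≡0⇒∑≡0 []          eq f = refl
∣s∣≡0⇒∑≡0 (false ∷ s) eq f = cong₂ _+_ (*-zeroʳ (f zero)) (∣s∣≡0⇒∑≡0 s eq (f ∘ suc))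

∣s∣≡1⇒singleton : ∀ {n} (s : Vec Bool n) → ∣ s ∣ₛ ≡ 1 → ∃[ i ] ∀ f → ∑ f s ≡ f i
∣s∣≡1⇒singleton (false ∷ s) eq =
  let i , s≡i = ∣s∣≡1⇒singleton s eq in suc i , λ f → cong₂ _+_ (*-zeroʳ (f zero)) (s≡i (f ∘ suc))
∣s∣≡1⇒singleton (true ∷ s)  eq = zero , λ f →
  trans (cong₂ _+_ (*-identityʳ (f zero)) (∣s∣≡0⇒∑≡0 s (suc-injective eq) (f ∘ suc))) (+-identityʳ (f zero))

-- Optimal solutions

∈-bitVectors : ∀ {n} (s : Vec Bool n) → s ∈ bitVectors n
∈-bitVectors []          = here refl
∈-bitVectors (false ∷ s) = ∈-++⁺ˡ (∈-map⁺ (false ∷_) (∈-bitVectors s))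
∈-bitVectors (true ∷ s)  = ∈-++⁺ʳ _ (∈-map⁺ (true ∷_) (∈-bitVectors s))

module _ (y : KnapsackInstance) where
  open KnapsackInstance y

  profit≤OPT : ∀ s → dot weights s ≤ capacity → dot profits s ≤ OPT
  profit≤OPT s feasible = All.lookup (xs≤max 0 _)
    (∈-map⁺ (dot profits) (∈-filter⁺ (λ z → dot weights z ≤? capacity) (∈-bitVectors s) feasible))

  OPT≤ : ∀ {v} → (∀ s → dot weights s ≤ capacity → dot profits s ≤ v) → OPT ≤ v
  OPT≤ {v} bounded = max≤v⁺ z≤n (All.tabulate small)
    where
    small : ∀ {p} → p ∈ map (dot profits) (filter (λ z → dot weights z ≤? capacity) (bitVectors n)) → p ≤ v
    small p∈ with ∈-map⁻ (dot profits) p∈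
    ... | s , s∈ , refl = bounded s (proj₂ (∈-filter⁻ (λ z → dot weights z ≤? capacity) {xs = bitVectors n} s∈))

lookup≤maximum : ∀ {n} (f : Fin n → ℕ) i → f i ≤ maximum (toList (tabulate f))
lookup≤maximum f i = All.lookup (xs≤max 0 _) (member f i)
  where
  member : ∀ {n} (f : Fin n → ℕ) i → f i ∈ toList (tabulate f)
  member f zero    = here refl
  member f (suc i) = there (member (f ∘ suc) i)

all-tabulate : ∀ {n v} (f : Fin n → ℕ) → (∀ i → f i ≤ v) → All.All (_≤ v) (toList (tabulate f))
all-tabulate {zero}  f f≤v = All.[]
all-tabulate {suc n} f f≤v = f≤v zero All.∷ all-tabulate (f ∘ suc) (f≤v ∘ suc)

maximum≤ : ∀ {l v} → All.All (_≤ v) l → maximum l ≤ v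
maximum≤ = max≤v⁺ z≤n

-- Selections of one item of each class

-- No summand exceeds 23, which leaves 4 · 4 · 3 candidates to be decided by evaluation.
6x+7y+10z≡23 : ∀ x y z → x * 6 + y * 7 + z * 10 ≡ 23 → x ≡ 1 × y ≡ 1 × z ≡ 1
6x+7y+10z≡23 x y z eq =
  subst₂ (λ x y → x ≡ 1 × y ≡ 1 × z ≡ 1) (toℕ-fromℕ< x<4) (toℕ-fromℕ< y<4)
    (subst (λ z → toℕ (fromℕ< x<4) ≡ 1 × toℕ (fromℕ< y<4) ≡ 1 × z ≡ 1) (toℕ-fromℕ< z<3)
      (search (fromℕ< x<4) (fromℕ< y<4) (fromℕ< z<3)
        (trans (cong₂ _+_ (cong₂ (λ x y → x * 6 + y * 7) (toℕ-fromℕ< x<4) (toℕ-fromℕ< y<4))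
                          (cong (_* 10) (toℕ-fromℕ< z<3))) eq)))
  where
  search : ∀ (x y : Fin 4) (z : Fin 3) → toℕ x * 6 + toℕ y * 7 + toℕ z * 10 ≡ 23 → toℕ x ≡ 1 × toℕ y ≡ 1 × toℕ z ≡ 1
  search = toWitness {a? = all? λ x → all? λ y → all? λ z →
    (toℕ x * 6 + toℕ y * 7 + toℕ z * 10 ≟ 23) →-dec (toℕ x ≟ 1 ×-dec toℕ y ≟ 1 ×-dec toℕ z ≟ 1)} _
  x<4 : x < 4
  x<4 = *-cancelʳ-< 6 x 4 (≤-<-trans (≤-trans (m≤m+n (x * 6) (y * 7)) (≤-trans (m≤m+n _ _) (≤-reflexive eq))) (≤-refl {24}))
  y<4 : y < 4
  y<4 = *-cancelʳ-< 7 y 4 (≤-<-trans (≤-trans (m≤n+m (y * 7) (x * 6)) (≤-trans (m≤m+n _ _) (≤-reflexive eq))) (m≤m+n 24 4))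
  z<3 : z < 3
  z<3 = *-cancelʳ-< 10 z 3 (≤-<-trans (≤-trans (m≤n+m (z * 10) _) (≤-reflexive eq)) (m≤m+n 24 6))

-- The total is read in base `M = N * 16`. Carries are the difficulty, as the number of selected
-- items is not bounded beforehand. So the order matters: the total gives `G ≤ 23`, this limits the
-- number of items and yields `R < M`, and only then can `G < 23` be excluded.
one-of-each : ∀ N x y z I J K → 0 < N → I ≤ x * N → J ≤ y * N → K ≤ z * (N + N) →
  x * (N * 96) + I + ((y * (N * 112) + J) + (z * (N * 160) + K)) ≡ N * 370 + 1 →
  (x ≡ 1 × y ≡ 1 × z ≡ 1) × I + J + K ≡ N * 2 + 1
one-of-each N x y z I J K N>0 I≤ J≤ K≤ eq = 6x+7y+10z≡23 x y z G≡23 , R≡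
  where
  M = N * 16
  G = x * 6 + y * 7 + z * 10
  R = I + J + K
  rearranged : G * M + R ≡ 23 * M + (N * 2 + 1)
  rearranged = trans (lhs N x y z I J K) (trans eq (rhs N))
    where
    lhs : ∀ n x y z i j k → (x * 6 + y * 7 + z * 10) * (n * 16) + (i + j + k)
          ≡ x * (n * 96) + i + ((y * (n * 112) + j) + (z * (n * 160) + k))
    lhs = solve-∀
    rhs : ∀ n → n * 370 + 1 ≡ 23 * (n * 16) + (n * 2 + 1)
    rhs = solve-∀
  2N+1<M : N * 2 + 1 < M
  2N+1<M = ≤-<-trans (+-monoʳ-≤ (N * 2) N>0) (subst (_< M) (three N) (*-monoʳ-< N {{>-nonZero N>0}} (m≤m+n 4 12)))
    where
    three : ∀ n → n * 3 ≡ n * 2 + n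
    three = solve-∀
  G≤23 : G ≤ 23
  G≤23 = ≮⇒≥ λ 23<G → <-irrefl (sym rearranged) (begin-strict
    23 * M + (N * 2 + 1)  <⟨ +-monoʳ-< (23 * M) 2N+1<M ⟩
    23 * M + M            ≡⟨ +-comm (23 * M) M ⟩
    24 * M                ≤⟨ *-monoˡ-≤ M 23<G ⟩
    G * M                 ≤⟨ m≤m+n (G * M) R ⟩
    G * M + R             ∎)
    where open ≤-Reasoning
  R<M : R < M
  R<M = begin-strict
    I + J + K                      ≤⟨ +-mono-≤ (+-mono-≤ I≤ J≤) K≤ ⟩
    x * N + y * N + z * (N + N)    ≡⟨ collect N x y z ⟩
    N * (x + y + z * 2)            <⟨ *-monoʳ-< N {{>-nonZero N>0}} few ⟩
    N * 16                         ∎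
    where
    open ≤-Reasoning
    collect : ∀ n x y z → x * n + y * n + z * (n + n) ≡ n * (x + y + z * 2)
    collect = solve-∀
    -- Compare coefficients: 3 (x + y + 2 z) is at most 6 x + 7 y + 10 z.
    few : x + y + z * 2 < 16
    few = *-cancelʳ-< 3 _ 16 (begin-strict
      (x + y + z * 2) * 3                           ≤⟨ m≤m+n _ (x * 3 + y * 4 + z * 4) ⟩
      (x + y + z * 2) * 3 + (x * 3 + y * 4 + z * 4)  ≡⟨ total x y z ⟩
      G                                             ≤⟨ G≤23 ⟩
      23                                            <⟨ m≤m+n 24 24 ⟩
      48                                            ∎)
      where
      total : ∀ x y z → (x + y + z * 2) * 3 + (x * 3 + y * 4 + z * 4) ≡ x * 6 + y * 7 + z * 10
      total = solve-∀
  G≡23 : G ≡ 23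
  G≡23 = ≤-antisym G≤23 (≮⇒≥ λ G<23 → <-irrefl rearranged (begin-strict
    G * M + R             <⟨ +-monoʳ-< (G * M) R<M ⟩
    G * M + M             ≡⟨ +-comm (G * M) M ⟩
    suc G * M             ≤⟨ *-monoˡ-≤ M G<23 ⟩
    23 * M                ≤⟨ m≤m+n (23 * M) (N * 2 + 1) ⟩
    23 * M + (N * 2 + 1)  ∎))
    where open ≤-Reasoning
  R≡ : R ≡ N * 2 + 1
  R≡ = +-cancelˡ-≡ (23 * M) R (N * 2 + 1) (trans (cong (λ g → g * M + R) (sym G≡23)) rearranged)

module Reduction (side : Side) (x : ConvolutionInstance) where
  open Source x
  open Items side N val
  open ItemBounds side N val val≤N

  at : (ℕ → ℕ) → Fin items → ℕ
  at f p = f (suc (toℕ p))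

  position< : ∀ (p : Fin items) → suc (toℕ p) < N + N + (N + N)
  position< p = subst (suc (toℕ p) <_) 1+items (s≤s (toℕ<n p))

  coarseᶠ excessᶠ : Fin items → ℕ
  coarseᶠ = at coarse
  excessᶠ = at excess

  coarse-a : ∀ (i : Fin N) → coarseᶠ (i ↑ˡ (N + (2 * N ∸ 1))) ≡ N * 96 + suc (toℕ i)
  coarse-a i rewrite toℕ-↑ˡ i (N + (2 * N ∸ 1)) | <ᵇ-false (toℕ<n i) = refl

  -- The offset 111 turns into 112 = 7 · 16 because the positions in this class start after the
  -- first N.
  coarse-b : ∀ (j : Fin N) → coarseᶠ (N ↑ʳ (j ↑ˡ (2 * N ∸ 1))) ≡ N * 112 + suc (toℕ j)
  coarse-b j rewrite toℕ-↑ʳ N (j ↑ˡ (2 * N ∸ 1)) | toℕ-↑ˡ j (2 * N ∸ 1)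
    | <ᵇ-true (s≤s (m≤m+n N (toℕ j)))
    | <ᵇ-false (subst (_≤ N + N) (+-suc N (toℕ j)) (+-monoʳ-≤ N (toℕ<n j))) = shift N (toℕ j)
    where
    shift : ∀ n j → n * 111 + suc (n + j) ≡ n * 112 + suc j
    shift = solve-∀

  private
    1+k≤2N : ∀ (k : Fin (2 * N ∸ 1)) → suc (toℕ k) ≤ N + N
    1+k≤2N k = ≤-trans (toℕ<n k) (≤-trans (m∸n≤m (2 * N) 1) (≤-reflexive (cong (N +_) (+-identityʳ N))))

    2N<C : ∀ (k : Fin (2 * N ∸ 1)) → N + N < suc (N + (N + toℕ k))
    2N<C k = s≤s (subst (N + N ≤_) (+-assoc N N (toℕ k)) (m≤m+n (N + N) (toℕ k)))

  -- The preceding classes use up 2 N of 164 N. The rest splits into 10 · 16 N and another 2 N, from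
  -- which k + 1 is subtracted without truncation.
  coarse-c : ∀ (k : Fin (2 * N ∸ 1)) → coarseᶠ (N ↑ʳ (N ↑ʳ k)) ≡ N * 160 + (N + N ∸ suc (toℕ k))
  coarse-c k rewrite toℕ-↑ʳ N (N ↑ʳ k) | toℕ-↑ʳ N k
    | <ᵇ-true (s≤s (m≤m+n N (N + toℕ k))) | <ᵇ-true (2N<C k) = begin
    N * 164 ∸ suc (N + (N + toℕ k))                   ≡⟨ cong₂ _∸_ (split164 N) (shift N (toℕ k)) ⟩
    N + N + (N * 160 + (N + N)) ∸ (N + N + suc (toℕ k))  ≡⟨ [m+n]∸[m+o]≡n∸o (N + N) _ _ ⟩
    N * 160 + (N + N) ∸ suc (toℕ k)                   ≡⟨ +-∸-assoc (N * 160) (1+k≤2N k) ⟩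
    N * 160 + (N + N ∸ suc (toℕ k))                   ∎
    where
    open ≡-Reasoning
    split164 : ∀ n → n * 164 ≡ n + n + (n * 160 + (n + n))
    split164 = solve-∀
    shift : ∀ n k → suc (n + (n + k)) ≡ n + n + suc k
    shift = solve-∀

  excess-a : ∀ (i : Fin N) → excessᶠ (i ↑ˡ (N + (2 * N ∸ 1))) ≡ a i
  excess-a i rewrite toℕ-↑ˡ i (N + (2 * N ∸ 1)) | <ᵇ-false (≤-trans (toℕ<n i) (m≤m+n N N)) = val-a i

  excess-b : ∀ (j : Fin N) → excessᶠ (N ↑ʳ (j ↑ˡ (2 * N ∸ 1))) ≡ b j
  excess-b j rewrite toℕ-↑ʳ N (j ↑ˡ (2 * N ∸ 1)) | toℕ-↑ˡ j (2 * N ∸ 1)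
    | <ᵇ-false (subst (_≤ N + N) (+-suc N (toℕ j)) (+-monoʳ-≤ N (toℕ<n j))) = val-b j

  excess-c : ∀ (k : Fin (2 * N ∸ 1)) → excessᶠ (N ↑ʳ (N ↑ʳ k)) ≡ N ∸ c k
  excess-c k rewrite toℕ-↑ʳ N (N ↑ʳ k) | toℕ-↑ʳ N k | <ᵇ-true (2N<C k) = cong (N ∸_) (val-c k)

  Triple : Set
  Triple = ∃[ i ] ∃[ j ] ∃[ k ] toℕ i + toℕ j ≡ toℕ k × a i + b j < c k

  -- Mentions neither weights nor profits, so one equivalence with `Triple` serves both sides.
  Solution : Vec Bool items → Set
  Solution s = ∑ coarseᶠ s ≡ coarseTarget × ∑ excessᶠ s < N

  ∑-classes : ∀ (f : Fin items → ℕ) (r : Vec Bool N) (s : Vec Bool N) (t : Vec Bool (2 * N ∸ 1)) →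
    ∑ f (r Vec.++ (s Vec.++ t)) ≡
      ∑ (f ∘ (_↑ˡ (N + (2 * N ∸ 1)))) r + (∑ (f ∘ (N ↑ʳ_) ∘ (_↑ˡ (2 * N ∸ 1))) s + ∑ (f ∘ (N ↑ʳ_) ∘ (N ↑ʳ_)) t)
  ∑-classes f r s t = trans (∑-++ f r (s Vec.++ t)) (cong (∑ (f ∘ (_↑ˡ (N + (2 * N ∸ 1)))) r +_) (∑-++ (f ∘ (N ↑ʳ_)) s t))

  c≤N : ∀ k → c k ≤ N
  c≤N k = toℕ≤pred[n] (lookup C k)

  triple⇒solution : Triple → ∃[ s ] Solution s
  triple⇒solution (i , j , k , i+j≡k , a+b<c) =
    let r , r≡i = singleton i
        s , s≡j = singleton j
        t , t≡k = singleton k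
        at-ijk = λ f → trans (∑-classes f r s t) (cong₂ _+_ (r≡i _) (cong₂ _+_ (s≡j _) (t≡k _)))
    in r Vec.++ (s Vec.++ t)
     , trans (at-ijk coarseᶠ) (trans (cong₂ _+_ (coarse-a i) (cong₂ _+_ (coarse-b j) (coarse-c k))) total)
     , subst (_< N) (sym (trans (at-ijk excessᶠ) (cong₂ _+_ (excess-a i) (cong₂ _+_ (excess-b j) (excess-c k))))) small
    where
    K = N + N ∸ suc (toℕ k)
    total : N * 96 + suc (toℕ i) + (N * 112 + suc (toℕ j) + (N * 160 + K)) ≡ N * 370 + 1
    total = begin
      N * 96 + suc (toℕ i) + (N * 112 + suc (toℕ j) + (N * 160 + K))  ≡⟨ gather N (toℕ i) (toℕ j) K ⟩
      N * 368 + 1 + (K + suc (toℕ i + toℕ j))                         ≡⟨ cong (λ z → N * 368 + 1 + (K + suc z)) i+j≡k ⟩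
      N * 368 + 1 + (K + suc (toℕ k))                                   ≡⟨ cong (N * 368 + 1 +_) (m∸n+n≡m (1+k≤2N k)) ⟩
      N * 368 + 1 + (N + N)                                             ≡⟨ finish N ⟩
      N * 370 + 1                                                       ∎
      where
      open ≡-Reasoning
      gather : ∀ n i j K → n * 96 + suc i + (n * 112 + suc j + (n * 160 + K)) ≡ n * 368 + 1 + (K + suc (i + j))
      gather = solve-∀
      finish : ∀ n → n * 368 + 1 + (n + n) ≡ n * 370 + 1
      finish = solve-∀
    small : a i + (b j + (N ∸ c k)) < N
    small = begin-strict
      a i + (b j + (N ∸ c k))   ≡⟨ +-assoc (a i) (b j) (N ∸ c k) ⟨
      a i + b j + (N ∸ c k)     <⟨ +-monoˡ-< (N ∸ c k) a+b<c ⟩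
      c k + (N ∸ c k)           ≡⟨ m+[n∸m]≡n (c≤N k) ⟩
      N                         ∎
      where open ≤-Reasoning

  solution⇒triple : ∀ s → Solution s → Triple
  solution⇒triple s₀ sol with Vec.splitAt N s₀
  ... | r , s₁ , refl with Vec.splitAt N s₁
  ...   | s , t , refl = go sol
    where
    pos : Fin N → ℕ
    pos i = suc (toℕ i)
    rev : Fin (2 * N ∸ 1) → ℕ
    rev k = N + N ∸ suc (toℕ k)
    ∑coarse≡ : ∑ coarseᶠ (r Vec.++ (s Vec.++ t)) ≡
      ∣ r ∣ₛ * (N * 96) + ∑ pos r + ((∣ s ∣ₛ * (N * 112) + ∑ pos s) + (∣ t ∣ₛ * (N * 160) + ∑ rev t))
    ∑coarse≡ = trans (∑-classes coarseᶠ r s t) (cong₂ _+_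
      (trans (∑-cong coarse-a r) (∑-const-+ (N * 96) pos r)) (cong₂ _+_
      (trans (∑-cong coarse-b s) (∑-const-+ (N * 112) pos s))
      (trans (∑-cong coarse-c t) (∑-const-+ (N * 160) rev t))))
    go : Solution (r Vec.++ (s Vec.++ t)) → Triple
    go (coarse≡ , excess<) =
      let (∣r∣≡1 , ∣s∣≡1 , ∣t∣≡1) , total = one-of-each N (∣ r ∣ₛ) (∣ s ∣ₛ) (∣ t ∣ₛ) (∑ pos r) (∑ pos s) (∑ rev t) N>0
            (∑-≤ N pos toℕ<n r) (∑-≤ N pos toℕ<n s) (∑-≤ (N + N) rev (λ k → m∸n≤m (N + N) (suc (toℕ k))) t)
            (trans (sym ∑coarse≡) coarse≡)
      in triple total excess< (∣s∣≡1⇒singleton r ∣r∣≡1) (∣s∣≡1⇒singleton s ∣s∣≡1) (∣s∣≡1⇒singleton t ∣t∣≡1)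
      where
      triple : ∑ pos r + ∑ pos s + ∑ rev t ≡ N * 2 + 1 → ∑ excessᶠ (r Vec.++ (s Vec.++ t)) < N →
        (∃[ i ] ∀ f → ∑ f r ≡ f i) → (∃[ j ] ∀ f → ∑ f s ≡ f j) → (∃[ k ] ∀ f → ∑ f t ≡ f k) → Triple
      triple total excess< (i , r≡i) (j , s≡j) (k , t≡k) = i , j , k , i+j≡k , a+b<c
        where
        positions : suc (toℕ i) + suc (toℕ j) + (N + N ∸ suc (toℕ k)) ≡ N * 2 + 1
        positions = trans (sym (cong₂ _+_ (cong₂ _+_ (r≡i pos) (s≡j pos)) (t≡k rev))) total
        i+j≡k : toℕ i + toℕ j ≡ toℕ k
        -- Adding k + 1 to both sides of `positions` undoes the truncated subtraction.
        i+j≡k = +-cancelˡ-≡ (2 + (N + N)) _ _ (begin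
          2 + (N + N) + (toℕ i + toℕ j)                                        ≡⟨ cong (λ z → 2 + z + (toℕ i + toℕ j)) (sym (m∸n+n≡m (1+k≤2N k))) ⟩
          2 + (N + N ∸ suc (toℕ k) + suc (toℕ k)) + (toℕ i + toℕ j)            ≡⟨ gather (toℕ i) (toℕ j) (N + N ∸ suc (toℕ k)) (suc (toℕ k)) ⟩
          suc (toℕ i) + suc (toℕ j) + (N + N ∸ suc (toℕ k)) + suc (toℕ k)      ≡⟨ cong (_+ suc (toℕ k)) positions ⟩
          N * 2 + 1 + suc (toℕ k)                                              ≡⟨ finish N (toℕ k) ⟩
          2 + (N + N) + toℕ k                                                  ∎)
          where
          open ≡-Reasoning
          gather : ∀ i j K k → 2 + (K + k) + (i + j) ≡ suc i + suc j + K + k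
          gather = solve-∀
          finish : ∀ n k → n * 2 + 1 + suc k ≡ 2 + (n + n) + k
          finish = solve-∀
        excesses : ∑ excessᶠ (r Vec.++ (s Vec.++ t)) ≡ a i + (b j + (N ∸ c k))
        excesses = trans (∑-classes excessᶠ r s t) (cong₂ _+_ (trans (r≡i (excessᶠ ∘ (_↑ˡ (N + (2 * N ∸ 1))))) (excess-a i))
          (cong₂ _+_ (trans (s≡j (excessᶠ ∘ (N ↑ʳ_) ∘ (_↑ˡ (2 * N ∸ 1)))) (excess-b j)) (trans (t≡k (excessᶠ ∘ (N ↑ʳ_) ∘ (N ↑ʳ_))) (excess-c k))))
        a+b<c : a i + b j < c k
        a+b<c = +-cancelʳ-< (N ∸ c k) _ _ (begin-strict
          a i + b j + (N ∸ c k)                    ≡⟨ +-assoc (a i) (b j) (N ∸ c k) ⟩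
          a i + (b j + (N ∸ c k))                  ≡⟨ excesses ⟨
          ∑ excessᶠ (r Vec.++ (s Vec.++ t))        <⟨ excess< ⟩
          N                                        ≡⟨ m+[n∸m]≡n (c≤N k) ⟨
          c k + (N ∸ c k)                          ∎)
          where open ≤-Reasoning

-- The Knapsack instance and its optimum

module _ (x : ConvolutionInstance) where
  open Source x

  private
    N≤N*96 : N ≤ N * 96
    N≤N*96 = m≤m*n N 96

  module ReducedItems (side : Side) where
    open Items side N val public
    open ItemBounds side N val val≤N
    open Reduction side x public

    -- Keeps the truncated subtraction in the fine profits exact.
    excess≤coarse*N : ∀ p → at excess p ≤ at coarse p * N
    excess≤coarse*N p = begin
      at excess p      ≤⟨ excess-≤ _ (s≤s z≤n) (position< p) ⟩
      N                ≤⟨ N≤N*96 ⟩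
      N * 96           ≤⟨ coarse-≥ _ (position< p) ⟩
      at coarse p      ≤⟨ m≤m*n _ N {{>-nonZero N>0}} ⟩
      at coarse p * N  ∎
      where open ≤-Reasoning

    N≤coarse : ∀ p → N ≤ at coarse p
    N≤coarse p = ≤-trans N≤N*96 (coarse-≥ _ (position< p))

    N≤fine : ∀ p → N ≤ at fine p
    N≤fine p = ≤-choose side
      (m+n≤o⇒m≤o∸n N (begin
        N + at excess p  ≤⟨ +-monoʳ-≤ N (excess-≤ _ (s≤s z≤n) (position< p)) ⟩
        N + N            ≡⟨ double N ⟩
        N * 2            ≤⟨ *-monoʳ-≤ N (m≤m+n 2 94) ⟩
        N * 96           ≤⟨ coarse-≥ _ (position< p) ⟩
        at coarse p      ≤⟨ m≤m*n _ N {{>-nonZero N>0}} ⟩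
        at coarse p * N  ∎))
      (≤-trans (N≤coarse p) (≤-trans (m≤m*n _ N {{>-nonZero N>0}}) (m≤m+n _ _)))
      where
      open ≤-Reasoning
      ≤-choose : ∀ side {x y b} → b ≤ x → b ≤ y → b ≤ choose side x y
      ≤-choose weightsCoarse b≤x b≤y = b≤x
      ≤-choose profitsCoarse b≤x b≤y = b≤y
      double : ∀ n → n + n ≡ n * 2
      double = solve-∀

    -- All upper bounds on the instance share the constant 400; the most demanding one needs 372,
    -- for the fine target.
    coarse≤ : ∀ p → at coarse p ≤ N * 400
    coarse≤ p = ≤-trans (coarse-≤ _ (position< p)) (*-monoʳ-≤ N (m≤m+n 164 236))

    coarse*N+excess≤ : ∀ p → at coarse p * N + at excess p ≤ N * 164 * N + N
    coarse*N+excess≤ p = +-mono-≤ (*-monoˡ-≤ N (coarse-≤ _ (position< p))) (excess-≤ _ (s≤s z≤n) (position< p))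

    fine≤ : ∀ p → at fine p ≤ N * N * 400
    fine≤ p = begin
      at fine p                    ≤⟨ choose-≤ side (≤-trans (m∸n≤m _ (at excess p)) (m≤m+n _ _)) ≤-refl ⟩
      at coarse p * N + at excess p  ≤⟨ coarse*N+excess≤ p ⟩
      N * 164 * N + N              ≤⟨ +-monoʳ-≤ (N * 164 * N) (m≤m*n N N {{>-nonZero N>0}}) ⟩
      N * 164 * N + N * N          ≡⟨ collect N ⟩
      N * N * 165                  ≤⟨ *-monoʳ-≤ (N * N) (m≤m+n 165 235) ⟩
      N * N * 400                  ∎
      where
      open ≤-Reasoning
      collect : ∀ n → n * 164 * n + n * n ≡ n * n * 165
      collect = solve-∀

    -- The item of A[0] witnesses that `w-max`, `p-max` and `OPT` are at least N.
    some : Fin items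
    some = fromℕ< N>0 ↑ˡ (N + (2 * N ∸ 1))

    weightᶠ profitᶠ : Fin items → ℕ
    weightᶠ = at weight
    profitᶠ = at profit

  private
    N≤weight : ∀ side p → N ≤ ReducedItems.weightᶠ side p
    N≤weight weightsCoarse = ReducedItems.N≤coarse weightsCoarse
    N≤weight profitsCoarse = ReducedItems.N≤fine profitsCoarse

    N≤profit : ∀ side p → N ≤ ReducedItems.profitᶠ side p
    N≤profit weightsCoarse = ReducedItems.N≤fine weightsCoarse
    N≤profit profitsCoarse = ReducedItems.N≤coarse profitsCoarse

  module _ (side : Side) where
    open ReducedItems side

    N≤w-max : N ≤ maximum (toList (tabulate weightᶠ))
    N≤w-max = ≤-trans (N≤weight side some) (lookup≤maximum weightᶠ some)

    N≤p-max : N ≤ maximum (toList (tabulate profitᶠ))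
    N≤p-max = ≤-trans (N≤profit side some) (lookup≤maximum profitᶠ some)

    knapsack : KnapsackInstance
    knapsack = record
      { n        = items
      ; weights  = tabulate weightᶠ
      ; profits  = tabulate profitᶠ
      ; capacity = limit
      ; w-max>0  = <-≤-trans N>0 N≤w-max
      ; p-max>0  = <-≤-trans N>0 N≤p-max
      }

  open KnapsackInstance

  private
    T : ℕ
    T = N * 370 + 1

    N≤T*N : N ≤ T * N
    N≤T*N = m≤n*m N T {{>-nonZero (m≤n+m 1 (N * 370))}}

    N≤T : N ≤ T
    N≤T = ≤-trans (m≤m*n N 370) (m≤m+n _ 1)

  module WeightsCoarse where
    open ReducedItems weightsCoarse

    fine+excess : ∀ s → ∑ profitᶠ s + ∑ excessᶠ s ≡ ∑ coarseᶠ s * N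
    fine+excess s = trans (∑-∸ _ excessᶠ excess≤coarse*N s) (∑-* coarseᶠ N s)

    solution⇒ : ∀ s → Solution s → threshold ≤ OPT (knapsack weightsCoarse)
    solution⇒ s (coarse≡ , excess<) = ≤-trans good
      (profit≤OPT (knapsack weightsCoarse) s (≤-reflexive coarse≡))
      where
      good : T * N ∸ N + 1 ≤ ∑ profitᶠ s
      good = +-cancelʳ-≤ (∑ excessᶠ s) _ _ (begin
        T * N ∸ N + 1 + ∑ excessᶠ s   ≡⟨ +-assoc (T * N ∸ N) 1 _ ⟩
        T * N ∸ N + suc (∑ excessᶠ s) ≤⟨ +-monoʳ-≤ (T * N ∸ N) excess< ⟩
        T * N ∸ N + N                 ≡⟨ m∸n+n≡m N≤T*N ⟩
        T * N                         ≡⟨ cong (_* N) coarse≡ ⟨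
        ∑ coarseᶠ s * N               ≡⟨ fine+excess s ⟨
        ∑ profitᶠ s + ∑ excessᶠ s     ∎)
        where open ≤-Reasoning

    -- A coarse deficit of one costs profit N, while the threshold lies only `N ∸ 1` below `T * N`.
    ⇒solution : ∀ s → ∑ weightᶠ s ≤ limit → threshold ≤ ∑ profitᶠ s → Solution s
    ⇒solution s feasible good = coarse≡ , excess<
      where
      coarse≡ : ∑ coarseᶠ s ≡ T
      coarse≡ = ≤-antisym feasible (≮⇒≥ λ coarse<T → m+1+n≰m (T * N ∸ N) {0} (begin
        T * N ∸ N + 1              ≤⟨ good ⟩
        ∑ profitᶠ s                ≤⟨ m≤m+n _ _ ⟩
        ∑ profitᶠ s + ∑ excessᶠ s  ≡⟨ fine+excess s ⟩
        ∑ coarseᶠ s * N            ≤⟨ m+n≤o⇒m≤o∸n _ (subst (_≤ T * N) (+-comm N _) (*-monoˡ-≤ N coarse<T)) ⟩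
        T * N ∸ N                  ∎))
        where open ≤-Reasoning
      excess< : ∑ excessᶠ s < N
      excess< = +-cancelˡ-≤ (T * N ∸ N) _ _ (begin
        T * N ∸ N + suc (∑ excessᶠ s)  ≡⟨ +-assoc (T * N ∸ N) 1 _ ⟨
        T * N ∸ N + 1 + ∑ excessᶠ s    ≤⟨ +-monoˡ-≤ (∑ excessᶠ s) good ⟩
        ∑ profitᶠ s + ∑ excessᶠ s      ≡⟨ fine+excess s ⟩
        ∑ coarseᶠ s * N                ≡⟨ cong (_* N) coarse≡ ⟩
        T * N                          ≡⟨ m∸n+n≡m N≤T*N ⟨
        T * N ∸ N + N                  ∎)
        where open ≤-Reasoning

  module ProfitsCoarse where
    open ReducedItems profitsCoarse

    weight≡ : ∀ s → ∑ weightᶠ s ≡ ∑ coarseᶠ s * N + ∑ excessᶠ s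
    weight≡ s = trans (∑-+ (λ p → coarseᶠ p * N) excessᶠ s) (cong (_+ ∑ excessᶠ s) (∑-* coarseᶠ N s))

    solution⇒ : ∀ s → Solution s → threshold ≤ OPT (knapsack profitsCoarse)
    solution⇒ s (coarse≡ , excess<) = subst (_≤ OPT (knapsack profitsCoarse)) coarse≡
      (profit≤OPT (knapsack profitsCoarse) s (begin
        ∑ weightᶠ s                  ≡⟨ weight≡ s ⟩
        ∑ coarseᶠ s * N + ∑ excessᶠ s ≡⟨ cong (λ u → u * N + ∑ excessᶠ s) coarse≡ ⟩
        T * N + ∑ excessᶠ s           ≤⟨ m+n≤o⇒m≤o∸n _ (subst (_≤ T * N + N) (+-comm 1 _) (+-monoʳ-< (T * N) excess<)) ⟩
        T * N + N ∸ 1                 ∎))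
      where open ≤-Reasoning

    1≤T*N+N : 1 ≤ T * N + N
    1≤T*N+N = ≤-trans N>0 (m≤n+m N (T * N))

    feasible< : ∀ s → ∑ weightᶠ s ≤ limit → ∑ coarseᶠ s * N + ∑ excessᶠ s < T * N + N
    feasible< s feasible = begin-strict
      ∑ coarseᶠ s * N + ∑ excessᶠ s  ≡⟨ weight≡ s ⟨
      ∑ weightᶠ s                   ≤⟨ feasible ⟩
      T * N + N ∸ 1                 <⟨ ∸-monoʳ-< {T * N + N} (s≤s z≤n) 1≤T*N+N ⟩
      T * N + N                     ∎
      where open ≤-Reasoning

    -- The capacity ends just before `suc T * N`, so a larger coarse sum is too heavy even without
    -- any excess. This also bounds `OPT` linearly.
    profit≤T : ∀ s → ∑ weightᶠ s ≤ limit → ∑ coarseᶠ s ≤ T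
    profit≤T s feasible = s≤s⁻¹ (*-cancelʳ-< N _ _ (begin-strict
      ∑ coarseᶠ s * N                ≤⟨ m≤m+n _ _ ⟩
      ∑ coarseᶠ s * N + ∑ excessᶠ s  <⟨ feasible< s feasible ⟩
      T * N + N                      ≡⟨ +-comm (T * N) N ⟩
      suc T * N                      ∎))
      where open ≤-Reasoning

    ⇒solution : ∀ s → ∑ weightᶠ s ≤ limit → threshold ≤ ∑ profitᶠ s → Solution s
    ⇒solution s feasible good = coarse≡ ,
      +-cancelˡ-< (T * N) _ _ (subst (λ u → u * N + ∑ excessᶠ s < T * N + N) coarse≡ (feasible< s feasible))
      where
      coarse≡ : ∑ coarseᶠ s ≡ T
      coarse≡ = ≤-antisym (profit≤T s feasible) good

  solution⇒threshold≤OPT : ∀ side s → Reduction.Solution side x s → Items.threshold side N val ≤ OPT (knapsack side)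
  solution⇒threshold≤OPT weightsCoarse = WeightsCoarse.solution⇒
  solution⇒threshold≤OPT profitsCoarse = ProfitsCoarse.solution⇒

  good⇒solution : ∀ side s → dot (weights (knapsack side)) s ≤ capacity (knapsack side) →
    Items.threshold side N val ≤ dot (profits (knapsack side)) s → Reduction.Solution side x s
  good⇒solution weightsCoarse = WeightsCoarse.⇒solution
  good⇒solution profitsCoarse = ProfitsCoarse.⇒solution

  verified⇒¬triple : ∀ side → Verified → ¬ Reduction.Triple side x
  verified⇒¬triple side verified (i , j , k , i+j≡k , a+b<c) = <⇒≱ a+b<c (≤-trans (verified k)
    (All.lookup (min≤xs (N + N) (sums (toℕ k)))
      (∈-map⁺ (λ (i , j) → a i + b j)
        (∈-filter⁺ (λ (i , j) → toℕ i + toℕ j ≟ toℕ k) (∈-cartesianProduct⁺ (∈-allFin i) (∈-allFin j)) i+j≡k))))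

  ¬triple⇒verified : ∀ side → ¬ Reduction.Triple side x → Verified
  -- The default `N + N` of the minimum does no harm, being at least `c k`.
  ¬triple⇒verified side ¬triple k = v≤min⁺ (≤-trans (Reduction.c≤N side x k) (m≤m+n N N)) (All.tabulate least)
    where
    least : ∀ {u} → u ∈ sums (toℕ k) → c k ≤ u
    least u∈ with ∈-map⁻ (λ (i , j) → a i + b j) u∈
    ... | (i , j) , ij∈ , refl = ≮⇒≥ λ a+b<c → ¬triple (i , j , k ,
      proj₂ (∈-filter⁻ (λ (i , j) → toℕ i + toℕ j ≟ toℕ k) {xs = cartesianProduct (allFin N) (allFin N)} ij∈) , a+b<c)

  -- Makes `threshold ∸ 1` a true predecessor, which turns a bound on `OPT` into a strict one.
  1≤threshold : ∀ side → 1 ≤ Items.threshold side N val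
  1≤threshold weightsCoarse = m≤n+m 1 _
  1≤threshold profitsCoarse = m≤n+m 1 _

  verified⇒OPT<threshold : ∀ side → Verified → OPT (knapsack side) < Items.threshold side N val
  verified⇒OPT<threshold side verified = ≤-<-trans
    (OPT≤ (knapsack side) {threshold ∸ 1} λ s feasible → ∸-monoˡ-≤ 1 (≰⇒> λ good →
      verified⇒¬triple side verified (solution⇒triple s (good⇒solution side s feasible good))))
    (∸-monoʳ-< {threshold} (s≤s z≤n) (1≤threshold side))
    where open ReducedItems side

  OPT<threshold⇒verified : ∀ side → OPT (knapsack side) < Items.threshold side N val → Verified
  OPT<threshold⇒verified side OPT< = ¬triple⇒verified side λ triple →
    let s , solution = triple⇒solution triple in <⇒≱ OPT< (solution⇒threshold≤OPT side s solution)
    where open ReducedItems side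

  OPT<threshold-correct : ∀ side → (OPT (knapsack side) <ᵇ Items.threshold side N val) ≡ does verified?
  OPT<threshold-correct side with OPT (knapsack side) <? Items.threshold side N val
  ... | yes OPT< = trans (<ᵇ-true OPT<) (sym (dec-true verified? (OPT<threshold⇒verified side OPT<)))
  ... | no OPT≮  = trans (<ᵇ-false (≮⇒≥ OPT≮)) (sym (dec-false verified? (OPT≮ ∘ verified⇒OPT<threshold side)))

  -- Bounds on the five parameters

  N≤items : N ≤ items
  N≤items = m≤m+n N _

  items≤ : items ≤ N * 400
  items≤ = begin
    items              ≤⟨ n≤1+n items ⟩
    suc items          ≡⟨ 1+items ⟩
    N + N + (N + N)    ≡⟨ quadruple N ⟩
    N * 4              ≤⟨ *-monoʳ-≤ N (m≤m+n 4 396) ⟩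
    N * 400            ∎
    where
    open ≤-Reasoning
    quadruple : ∀ n → n + n + (n + n) ≡ n * 4
    quadruple = solve-∀

  private
    T≤ : T ≤ N * 371
    T≤ = ≤-trans (+-monoʳ-≤ (N * 370) N>0) (≤-reflexive (one-more N))
      where
      one-more : ∀ n → n * 370 + n ≡ n * 371
      one-more = solve-∀

    T*N+N≤ : T * N + N ≤ N * N * 400
    T*N+N≤ = begin
      T * N + N               ≤⟨ +-mono-≤ (*-monoˡ-≤ N T≤) (m≤m*n N N {{>-nonZero N>0}}) ⟩
      N * 371 * N + N * N     ≡⟨ collect N ⟩
      N * N * 372             ≤⟨ *-monoʳ-≤ (N * N) (m≤m+n 372 28) ⟩
      N * N * 400             ∎
      where
      open ≤-Reasoning
      collect : ∀ n → n * 371 * n + n * n ≡ n * n * 372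
      collect = solve-∀

  T≤N*400 : T ≤ N * 400
  T≤N*400 = ≤-trans T≤ (*-monoʳ-≤ N (m≤m+n 371 29))

  fineTarget≤ : T * N + N ∸ 1 ≤ N * N * 400
  fineTarget≤ = ≤-trans (m∸n≤m _ 1) T*N+N≤

  N≤capacity : ∀ side → N ≤ capacity (knapsack side)
  N≤capacity weightsCoarse = N≤T
  N≤capacity profitsCoarse = m+n≤o⇒m≤o∸n N (≤-trans (≤-reflexive (+-comm N 1)) (+-mono-≤ (≤-trans N>0 N≤T*N) ≤-refl))

  coarse-fits : ∀ p → ReducedItems.coarseᶠ weightsCoarse p ≤ T
  coarse-fits p = ≤-trans (ItemBounds.coarse-≤ weightsCoarse N val val≤N _ (ReducedItems.position< weightsCoarse p))
    (≤-trans (*-monoʳ-≤ N (m≤m+n 164 206)) (m≤m+n (N * 370) 1))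

  fine-fits : ∀ p → ReducedItems.weightᶠ profitsCoarse p ≤ T * N + N ∸ 1
  fine-fits p = m+n≤o⇒m≤o∸n _ (begin
    coarseᶠ p * N + excessᶠ p + 1  ≤⟨ +-monoˡ-≤ 1 (coarse*N+excess≤ p) ⟩
    N * 164 * N + N + 1            ≤⟨ +-mono-≤ (+-monoˡ-≤ N (*-monoˡ-≤ N (*-monoʳ-≤ N (m≤m+n 164 206)))) N>0 ⟩
    N * 370 * N + N + N            ≡⟨ regroup N 370 ⟩
    T * N + N                      ∎)
    where
    open ReducedItems profitsCoarse
    open ≤-Reasoning
    regroup : ∀ n c → n * c * n + n + n ≡ (n * c + 1) * n + n
    regroup = solve-∀

  weight-fits : ∀ side p → ReducedItems.weightᶠ side p ≤ capacity (knapsack side)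
  weight-fits weightsCoarse = coarse-fits
  weight-fits profitsCoarse = fine-fits

  -- The selection of the single item `some` is feasible.
  N≤OPT : ∀ side → N ≤ OPT (knapsack side)
  N≤OPT side =
    let s , s≡some = singleton some
    in ≤-trans (N≤profit side some) (subst (_≤ OPT (knapsack side)) (s≡some profitᶠ)
         (profit≤OPT (knapsack side) s (subst (_≤ limit) (sym (s≡some weightᶠ)) (weight-fits side some))))
    where open ReducedItems side

  OPT≤N*400 : OPT (knapsack profitsCoarse) ≤ N * 400
  OPT≤N*400 = ≤-trans (OPT≤ (knapsack profitsCoarse) ProfitsCoarse.profit≤T) T≤N*400

  z≥N : ∀ side z → N ≤ value (knapsack side) z
  z≥N side `n     = N≤items
  z≥N side `w-max = N≤w-max side
  z≥N side `p-max = N≤p-max side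
  z≥N side `t     = N≤capacity side
  z≥N side `OPT   = N≤OPT side

  coarse-max≤ : ∀ side → maximum (toList (tabulate (ReducedItems.coarseᶠ side))) ≤ N * 400
  coarse-max≤ side = maximum≤ (all-tabulate _ (ReducedItems.coarse≤ side))

  fine-max≤ : ∀ side → maximum (toList (tabulate (Reduction.at side x (Items.fine side N val)))) ≤ N * N * 400
  fine-max≤ side = maximum≤ (all-tabulate _ (ReducedItems.fine≤ side))

-- Arithmetic of the time bounds

^-distribʳ-* : ∀ m n k → (m * n) ^ k ≡ m ^ k * n ^ k
^-distribʳ-* m n zero    = refl
^-distribʳ-* m n (suc k) = trans (cong (m * n *_) (^-distribʳ-* m n k)) (interchange m n (m ^ k) (n ^ k))
  where
  interchange : ∀ x y u v → x * y * (u * v) ≡ x * u * (y * v)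
  interchange = solve-∀

^-cancelʳ-≤ : ∀ k m n .{{_ : NonZero k}} → m ^ k ≤ n ^ k → m ≤ n
^-cancelʳ-≤ k m n m^k≤n^k = ≮⇒≥ λ n<m → <⇒≱ (^-monoˡ-< k n<m) m^k≤n^k

m≤m^n : ∀ m n → 0 < n → m ≤ m ^ n
m≤m^n zero    n       n>0 = z≤n
m≤m^n (suc m) (suc n) n>0 = m≤m*n (suc m) (suc m ^ n) {{m^n≢0 (suc m) n}}

-- The sum is at most twice the larger summand.
[m+n]^k≤ : ∀ m n k → (m + n) ^ k ≤ 2 ^ k * (m ^ k + n ^ k)
[m+n]^k≤ m n k with ≤-total m n
... | inj₁ m≤n = begin
  (m + n) ^ k              ≤⟨ ^-monoˡ-≤ k (+-mono-≤ m≤n (≤-reflexive (sym (+-identityʳ n)))) ⟩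
  (2 * n) ^ k              ≡⟨ ^-distribʳ-* 2 n k ⟩
  2 ^ k * n ^ k            ≤⟨ *-monoʳ-≤ (2 ^ k) (m≤n+m (n ^ k) (m ^ k)) ⟩
  2 ^ k * (m ^ k + n ^ k)  ∎
  where open ≤-Reasoning
... | inj₂ n≤m = begin
  (m + n) ^ k              ≤⟨ ^-monoˡ-≤ k (+-monoʳ-≤ m (≤-trans n≤m (≤-reflexive (sym (+-identityʳ m))))) ⟩
  (2 * m) ^ k              ≡⟨ ^-distribʳ-* 2 m k ⟩
  2 ^ k * m ^ k            ≤⟨ *-monoʳ-≤ (2 ^ k) (m≤m+n (m ^ k) (n ^ k)) ⟩
  2 ^ k * (m ^ k + n ^ k)  ∎
  where open ≤-Reasoning

n<2^bitLength : ∀ n → n < 2 ^ bitLength n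
n<2^bitLength n = ≰⇒> λ 2^l≤n → 1+n≰n (≤-trans (≤-reflexive (sym (⌊log₂[2^n]⌋≡n (bitLength n)))) (⌊log₂⌋-mono-≤ 2^l≤n))

2^⌊log₂n⌋≤n : ∀ n → 0 < n → 2 ^ ⌊log₂ n ⌋ ≤ n
2^⌊log₂n⌋≤n n n>0 = ≮⇒≥ λ n<2^l → 1+n≰n (log< ⌊log₂ n ⌋ n n>0 n<2^l)
  where
  -- Halving `n` lowers both the exponent and the logarithm by one.
  log< : ∀ k n → 0 < n → n < 2 ^ k → ⌊log₂ n ⌋ < k
  log< zero    (suc n)         n>0 (s≤s ())
  log< (suc k) 1               n>0 n<  = s≤s z≤n
  log< (suc k) n@(suc (suc m)) n>0 n<  = s≤s (≤-trans (m≤n+m∸n ⌊log₂ n ⌋ 1)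
    (subst (_< k) (⌊log₂⌊n/2⌋⌋≡⌊log₂n⌋∸1 n) (log< k ⌊ n /2⌋ (s≤s z≤n) halved)))
    where
    halved : ⌊ n /2⌋ < 2 ^ k
    halved = *-cancelˡ-< 2 _ _ (≤-<-trans (begin
      2 * ⌊ n /2⌋           ≡⟨ cong (⌊ n /2⌋ +_) (+-identityʳ _) ⟩
      ⌊ n /2⌋ + ⌊ n /2⌋     ≤⟨ +-monoʳ-≤ ⌊ n /2⌋ (⌊n/2⌋≤⌈n/2⌉ n) ⟩
      ⌊ n /2⌋ + ⌈ n /2⌉     ≡⟨ ⌊n/2⌋+⌈n/2⌉≡n n ⟩
      n                     ∎) n<)
      where open ≤-Reasoning

bitLength-mono : ∀ {m n} → m ≤ n → bitLength m ≤ bitLength n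
bitLength-mono m≤n = s≤s (⌊log₂⌋-mono-≤ m≤n)

bitLength-≤ : ∀ {n k} → n < 2 ^ k → 0 < k → bitLength n ≤ k
bitLength-≤ {zero}  {k} n<2^k k>0 = k>0
bitLength-≤ {suc n} {k} n<2^k k>0 = ≰⇒> λ k≤l →
  <⇒≱ n<2^k (≤-trans (^-monoʳ-≤ 2 k≤l) (2^⌊log₂n⌋≤n (suc n) (s≤s z≤n)))

1+n≤2^n : ∀ n → suc n ≤ 2 ^ n
1+n≤2^n zero    = ≤-refl
1+n≤2^n (suc n) = ≤-trans (+-mono-≤ (m^n>0 2 n) (1+n≤2^n n)) (≤-reflexive (cong (2 ^ n +_) (sym (+-identityʳ _))))

-- Writing l = q k + r with r < k, one has l + 1 ≤ k (q + 1) ≤ k 2^q.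
[1+l]^k≤ : ∀ k l .{{_ : NonZero k}} → suc l ^ k ≤ k ^ k * 2 ^ l
[1+l]^k≤ k l = begin
  suc l ^ k             ≤⟨ ^-monoˡ-≤ k (begin
    suc l                         ≡⟨ cong suc (m≡m%n+[m/n]*n l k) ⟩
    suc (l % k) + l / k * k       ≤⟨ +-monoˡ-≤ (l / k * k) (m%n<n l k) ⟩
    k + l / k * k                 ≡⟨ *-comm (suc (l / k)) k ⟩
    k * suc (l / k)               ≤⟨ *-monoʳ-≤ k (1+n≤2^n (l / k)) ⟩
    k * 2 ^ (l / k)               ∎) ⟩
  (k * 2 ^ (l / k)) ^ k         ≡⟨ ^-distribʳ-* k (2 ^ (l / k)) k ⟩
  k ^ k * (2 ^ (l / k)) ^ k     ≡⟨ cong (k ^ k *_) (^-*-assoc 2 (l / k) k) ⟩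
  k ^ k * 2 ^ (l / k * k)       ≤⟨ *-monoʳ-≤ (k ^ k) (^-monoʳ-≤ 2 (m/n*n≤m l k)) ⟩
  k ^ k * 2 ^ l                 ∎
  where open ≤-Reasoning

polylog≤linear : ∀ k → ∃[ D ] ∀ n → 0 < n → bitLength n ^ k ≤ D * n
-- The exponent is raised to `suc k` because the estimate divides by it.
polylog≤linear k = suc k ^ suc k , λ n n>0 → begin
  bitLength n ^ k                       ≤⟨ ^-monoʳ-≤ (bitLength n) (n≤1+n k) ⟩
  bitLength n ^ suc k                   ≤⟨ [1+l]^k≤ (suc k) ⌊log₂ n ⌋ ⟩
  suc k ^ suc k * 2 ^ ⌊log₂ n ⌋         ≤⟨ *-monoʳ-≤ (suc k ^ suc k) (2^⌊log₂n⌋≤n n n>0) ⟩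
  suc k ^ suc k * n                     ∎
  where open ≤-Reasoning

-- `h` is the factor by which the logarithm for the Knapsack instance may exceed `bitLength n`. The
-- summand 1 lets the same factor cover the linear cost of the reduction itself.
[1+C*L^c]^k≤linear : ∀ C c h k → ∃[ D ] ∀ n L → 0 < n → 0 < L → L ≤ bitLength n * h → (1 + C * L ^ c) ^ k ≤ D * n
[1+C*L^c]^k≤linear C c h k =
  let D , polylog = polylog≤linear (c * k)
  in suc C ^ k * h ^ (c * k) * D , λ n L n>0 L>0 L≤ → begin
    (1 + C * L ^ c) ^ k                                      ≤⟨ ^-monoˡ-≤ k (+-monoˡ-≤ (C * L ^ c) (m^n>0 L {{>-nonZero L>0}} c)) ⟩
    (suc C * L ^ c) ^ k                                      ≡⟨ ^-distribʳ-* (suc C) (L ^ c) k ⟩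
    suc C ^ k * (L ^ c) ^ k                                  ≡⟨ cong (suc C ^ k *_) (^-*-assoc L c k) ⟩
    suc C ^ k * L ^ (c * k)                                  ≤⟨ *-monoʳ-≤ (suc C ^ k) (^-monoˡ-≤ (c * k) L≤) ⟩
    suc C ^ k * (bitLength n * h) ^ (c * k)                  ≡⟨ cong (suc C ^ k *_) (^-distribʳ-* (bitLength n) h (c * k)) ⟩
    suc C ^ k * (bitLength n ^ (c * k) * h ^ (c * k))        ≤⟨ *-monoʳ-≤ (suc C ^ k) (*-monoˡ-≤ (h ^ (c * k)) (polylog n n>0)) ⟩
    suc C ^ k * (D * n * h ^ (c * k))                      ≡⟨ regroup (suc C ^ k) (h ^ (c * k)) D n ⟩
    suc C ^ k * h ^ (c * k) * D * n                          ∎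
  where
  open ≤-Reasoning
  regroup : ∀ x y z n → x * (z * n * y) ≡ x * y * z * n
  regroup = solve-∀

-- X is the part of the running time that is due to R / z^δ ≤ E N² / N^(a/b).
dominant : ∀ {X z K N E S} a b → 0 < a → 0 < N → N ≤ z → S ≤ (N * N * E) ^ 6 →
  X ^ (6 * b) * z ^ (6 * a) ≤ K ^ (6 * b) * S ^ b → X ^ b * N ≤ (K * (N * N * E)) ^ b
dominant {X} {z} {K} {N} {E} {S} a b a>0 N>0 N≤z S≤ bound = ^-cancelʳ-≤ 6 _ _ (begin
  -- This is where the saving N^(a/b) is weakened to N^(1/b).
  (X ^ b * N) ^ 6                         ≤⟨ ^-monoˡ-≤ 6 (*-monoʳ-≤ (X ^ b) (m≤m^n N a a>0)) ⟩
  (X ^ b * N ^ a) ^ 6                     ≡⟨ ^-distribʳ-* (X ^ b) (N ^ a) 6 ⟩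
  (X ^ b) ^ 6 * (N ^ a) ^ 6               ≡⟨ cong₂ _*_ (swap X b) (swap N a) ⟩
  X ^ (6 * b) * N ^ (6 * a)               ≤⟨ *-monoʳ-≤ (X ^ (6 * b)) (^-monoˡ-≤ (6 * a) N≤z) ⟩
  X ^ (6 * b) * z ^ (6 * a)               ≤⟨ bound ⟩
  K ^ (6 * b) * S ^ b                     ≤⟨ *-monoʳ-≤ (K ^ (6 * b)) (^-monoˡ-≤ b S≤) ⟩
  K ^ (6 * b) * ((N * N * E) ^ 6) ^ b   ≡⟨ cong₂ _*_ (sym (swap K b)) (trans (^-*-assoc (N * N * E) 6 b) (sym (swap (N * N * E) b))) ⟩
  (K ^ b) ^ 6 * ((N * N * E) ^ b) ^ 6   ≡⟨ ^-distribʳ-* (K ^ b) ((N * N * E) ^ b) 6 ⟨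
  (K ^ b * (N * N * E) ^ b) ^ 6         ≡⟨ cong (_^ 6) (sym (^-distribʳ-* K (N * N * E) b)) ⟩
  ((K * (N * N * E)) ^ b) ^ 6           ∎)
  where
  open ≤-Reasoning
  swap : ∀ n k → (n ^ k) ^ 6 ≡ n ^ (6 * k)
  swap n k = trans (^-*-assoc n k 6) (cong (n ^_) (*-comm k 6))

-- Squaring doubles the saved factor `N`: one copy pays for `K ^ (b + b) ≤ D * N`, the other
-- remains.
dominant² : ∀ {X K N E D} b → 0 < N → K ^ (b + b) ≤ D * N → X ^ b * N ≤ (K * (N * N * E)) ^ b →
  X ^ (b + b) * N ≤ D * E ^ (b + b) * N ^ (2 * (b + b))
dominant² {X} {K} {N} {E} {D} b N>0 K≤ bound = *-cancelʳ-≤ _ _ N {{>-nonZero N>0}} (begin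
  X ^ (b + b) * N * N                           ≡⟨ cong (λ x → x * N * N) (^-distribˡ-+-* X b b) ⟩
  X ^ b * X ^ b * N * N                         ≡⟨ square (X ^ b) N ⟩
  (X ^ b * N) * (X ^ b * N)                     ≤⟨ *-mono-≤ bound bound ⟩
  (K * (N * N * E)) ^ b * (K * (N * N * E)) ^ b  ≡⟨ ^-distribˡ-+-* (K * (N * N * E)) b b ⟨
  (K * (N * N * E)) ^ (b + b)                 ≡⟨ ^-distribʳ-* K (N * N * E) (b + b) ⟩
  K ^ (b + b) * (N * N * E) ^ (b + b)         ≤⟨ *-monoˡ-≤ ((N * N * E) ^ (b + b)) K≤ ⟩
  D * N * (N * N * E) ^ (b + b)               ≡⟨ cong (D * N *_) (^-distribʳ-* (N * N) E (b + b)) ⟩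
  D * N * ((N * N) ^ (b + b) * E ^ (b + b))     ≡⟨ cong (λ x → D * N * (x * E ^ (b + b))) N²^ ⟩
  D * N * (N ^ (2 * (b + b)) * E ^ (b + b))     ≡⟨ regroup D N (E ^ (b + b)) (N ^ (2 * (b + b))) ⟩
  D * E ^ (b + b) * N ^ (2 * (b + b)) * N       ∎)
  where
  open ≤-Reasoning
  square : ∀ x n → x * x * n * n ≡ (x * n) * (x * n)
  square = solve-∀
  regroup : ∀ d n e x → d * n * (x * e) ≡ d * e * x * n
  regroup = solve-∀
  N²^ : (N * N) ^ (b + b) ≡ N ^ (2 * (b + b))
  N²^ = trans (cong (_^ (b + b)) (cong (N *_) (sym (*-identityʳ N)))) (^-*-assoc N 2 (b + b))

-- Since b + b is at least 2, the exponent 2 + (b + b) is at most 2 (b + b).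
linear² : ∀ {K N F D} b → 0 < b → 0 < N → K ^ (b + b) ≤ D * N →
  (K * F * N) ^ (b + b) * N ≤ D * F ^ (b + b) * N ^ (2 * (b + b))
linear² {K} {N} {F} {D} b b>0 N>0 K≤ = begin
  (K * F * N) ^ m * N                     ≡⟨ cong (_* N) (trans (^-distribʳ-* (K * F) N m) (cong (_* N ^ m) (^-distribʳ-* K F m))) ⟩
  K ^ m * F ^ m * N ^ m * N               ≤⟨ *-monoˡ-≤ N (*-monoˡ-≤ (N ^ m) (*-monoˡ-≤ (F ^ m) K≤)) ⟩
  D * N * F ^ m * N ^ m * N             ≡⟨ regroup (F ^ m) D N (N ^ m) ⟩
  D * F ^ m * N ^ (2 + m)                 ≤⟨ *-monoʳ-≤ (D * F ^ m) (^-monoʳ-≤ N {{>-nonZero N>0}}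
                                               (+-mono-≤ (+-mono-≤ b>0 b>0) (≤-reflexive (sym (+-identityʳ m))))) ⟩
  D * F ^ m * N ^ (2 * m)                 ∎
  where
  open ≤-Reasoning
  m = b + b
  regroup : ∀ f d n x → d * n * f * x * n ≡ d * f * (n * (n * x))
  regroup = solve-∀

subquadratic : ∀ {X K N E F D T} b → 0 < b → 0 < N → K ^ (b + b) ≤ D * N →
  X ^ b * N ≤ (K * (N * N * E)) ^ b → T ≤ X + K * F * N →
  T ^ (b + b) * N ^ 1 ≤ (2 * (D * (E ^ (b + b) + F ^ (b + b)))) ^ (b + b) * N ^ (2 * (b + b))
subquadratic {X} {K} {N} {E} {F} {D} {T} b b>0 N>0 K≤ X≤ T≤ = begin
  T ^ m * N ^ 1                                 ≡⟨ cong (T ^ m *_) (*-identityʳ N) ⟩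
  T ^ m * N                                     ≤⟨ *-monoˡ-≤ N (^-monoˡ-≤ m T≤) ⟩
  (X + K * F * N) ^ m * N                       ≤⟨ *-monoˡ-≤ N ([m+n]^k≤ X (K * F * N) m) ⟩
  2 ^ m * (X ^ m + (K * F * N) ^ m) * N         ≡⟨ spread (2 ^ m) (X ^ m) ((K * F * N) ^ m) N ⟩
  2 ^ m * (X ^ m * N + (K * F * N) ^ m * N)     ≤⟨ *-monoʳ-≤ (2 ^ m) (+-mono-≤ (dominant² {X} {K} {N} {E} {D} b N>0 K≤ X≤) (linear² {K} {N} {F} {D} b b>0 N>0 K≤)) ⟩
  2 ^ m * (D * E ^ m * N ^ (2 * m) + D * F ^ m * N ^ (2 * m))  ≡⟨ collect (2 ^ m) D (E ^ m) (F ^ m) (N ^ (2 * m)) ⟩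
  -- The constant has to appear as an `m`-th power, the form in which the time bound is stated.
  2 ^ m * (D * (E ^ m + F ^ m)) * N ^ (2 * m)   ≤⟨ *-monoˡ-≤ (N ^ (2 * m)) (*-monoʳ-≤ (2 ^ m) (m≤m^n _ m (≤-trans b>0 (m≤m+n b b)))) ⟩
  2 ^ m * (D * (E ^ m + F ^ m)) ^ m * N ^ (2 * m)  ≡⟨ cong (_* N ^ (2 * m)) (^-distribʳ-* 2 (D * (E ^ m + F ^ m)) m) ⟨
  (2 * (D * (E ^ m + F ^ m))) ^ m * N ^ (2 * m) ∎
  where
  open ≤-Reasoning
  m = b + b
  spread : ∀ t x y n → t * (x + y) * n ≡ t * (x * n + y * n)
  spread = solve-∀
  collect : ∀ t d e f n → t * (d * e * n + d * f * n) ≡ t * (d * (e + f)) * n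
  collect = solve-∀

-- Sizes of the Knapsack instance

sideOf : Expression → Side
sideOf `t√p-max                 = weightsCoarse
sideOf `⟨n·w-max·p-max⟩^⅓·t^⅔   = weightsCoarse
sideOf `OPT√w-max               = profitsCoarse
sideOf `⟨n·w-max·p-max⟩^⅓·OPT^⅔ = profitsCoarse

-- Constants are traded for powers of β: 400 is at most 2^9, and 1 + 9 + 2 + 9 = 21.
length*largest≤ : ∀ n β → 2 ≤ β → n ≤ β → n * 400 * (n * n * 400) ≤ β ^ 21
length*largest≤ n β 2≤β n≤β = begin
  n * 400 * (n * n * 400)        ≤⟨ *-mono-≤ (*-mono-≤ n≤β 400≤) (*-mono-≤ (*-mono-≤ n≤β n≤β) 400≤) ⟩
  β * β ^ 9 * (β * β * β ^ 9)    ≡⟨ cong (β ^ 10 *_) (*-assoc β β (β ^ 9)) ⟩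
  β ^ 10 * β ^ 11                ≡⟨ ^-distribˡ-+-* β 10 11 ⟨
  β ^ 21                         ∎
  where
  open ≤-Reasoning
  400≤ : 400 ≤ β ^ 9
  400≤ = ≤-trans (m≤m+n 400 112) (2^k≤β^k 9)
    where
    2^k≤β^k : ∀ k → 2 ^ k ≤ β ^ k
    2^k≤β^k k = ^-monoˡ-≤ k 2≤β

n*n*1024≤ : ∀ n β → 2 ≤ β → n ≤ β → n * n * 1024 ≤ β ^ 12
n*n*1024≤ n β 2≤β n≤β = begin
  n * n * 1024     ≤⟨ *-mono-≤ (*-mono-≤ n≤β n≤β) (2^k≤β^k 10) ⟩
  β * β * β ^ 10   ≡⟨ *-assoc β β (β ^ 10) ⟩
  β ^ 12           ∎
  where
  open ≤-Reasoning
  2^k≤β^k : ∀ k → 2 ^ k ≤ β ^ k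
  2^k≤β^k k = ^-monoˡ-≤ k 2≤β

2≤2^bitLength : ∀ n → 2 ≤ 2 ^ bitLength n
2≤2^bitLength n = *-monoʳ-≤ 2 (m^n>0 2 ⌊log₂ n ⌋)

^<2^ : ∀ n {j k} → j < k → (2 ^ bitLength n) ^ j < 2 ^ (bitLength n * k)
^<2^ n {j} {k} j<k = subst ((2 ^ bitLength n) ^ j <_) (^-*-assoc 2 (bitLength n) k)
  (^-monoʳ-< (2 ^ bitLength n) (2≤2^bitLength n) j<k)

logNU-bound : ∀ (y : KnapsackInstance) {N} → KnapsackInstance.n y ≤ N * 400 →
  All.All (_≤ N * N * 400) (Problem.input Knapsack y) → Problem.logNU Knapsack y ≤ bitLength N * 22
logNU-bound y {N} n≤ inputs≤ = bitLength-≤ {n = volume} {k = bitLength N * 22} volume< positive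
  where
  volume = KnapsackInstance.n y * maximum (Problem.input Knapsack y)
  positive : 0 < bitLength N * 22
  positive = s≤s z≤n
  volume≤ : volume ≤ (2 ^ bitLength N) ^ 21
  volume≤ = ≤-trans (*-mono-≤ n≤ (maximum≤ inputs≤))
    (length*largest≤ N (2 ^ bitLength N) (2≤2^bitLength N) (<⇒≤ (n<2^bitLength N)))
  volume< : volume < 2 ^ (bitLength N * 22)
  volume< = ≤-<-trans {j = (2 ^ bitLength N) ^ 21} volume≤ (^<2^ N {21} {22} ≤-refl)

module _ (x : ConvolutionInstance) where
  open Source x

  private
    u : ℕ
    u = N * 400

    N*N*400≤u*u : N * N * 400 ≤ u * u
    N*N*400≤u*u = ≤-trans (m≤m*n (N * N * 400) 400) (≤-reflexive (regroup N 400))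
      where
      regroup : ∀ n c → n * n * c * c ≡ n * c * (n * c)
      regroup = solve-∀

    u*u^6 : (u * u) ^ 6 ≡ (N * N * 160000) ^ 6
    u*u^6 = cong (_^ 6) (regroup N 400)
      where
      regroup : ∀ n c → n * c * (n * c) ≡ n * n * (c * c)
      regroup = solve-∀

    -- In `u` the quantity t has degree 1 and p degree 2, so R⁶ has degree 6 + 2 · 3 = 12 here and 2
    -- (1 + 1 + 2) + 4 = 12 in `balanced′`; thus R is at most u² = 160000 N².
    balanced : ∀ {t p} → t ≤ u → p ≤ N * N * 400 → t ^ 6 * p ^ 3 ≤ (N * N * 160000) ^ 6
    balanced {t} {p} t≤ p≤ = begin
      t ^ 6 * p ^ 3          ≤⟨ *-mono-≤ (^-monoˡ-≤ 6 t≤) (^-monoˡ-≤ 3 (≤-trans p≤ N*N*400≤u*u)) ⟩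
      u ^ 6 * (u * u) ^ 3    ≡⟨ powers u ⟩
      (u * u) ^ 6            ≡⟨ u*u^6 ⟩
      (N * N * 160000) ^ 6   ∎
      where
      open ≤-Reasoning
      powers : ∀ u → u ^ 6 * (u * u) ^ 3 ≡ (u * u) ^ 6
      powers u = trans (cong (u ^ 6 *_) (trans (^-distribʳ-* u u 3) (sym (^-distribˡ-+-* u 3 3))))
                       (sym (^-distribʳ-* u u 6))

    balanced′ : ∀ {n w p t} → n ≤ u → w ≤ u → p ≤ N * N * 400 → t ≤ u →
                (n * w * p) ^ 2 * t ^ 4 ≤ (N * N * 160000) ^ 6
    balanced′ {n} {w} {p} {t} n≤ w≤ p≤ t≤ = begin
      (n * w * p) ^ 2 * t ^ 4
        ≤⟨ *-mono-≤ (^-monoˡ-≤ 2 (*-mono-≤ (*-mono-≤ n≤ w≤) (≤-trans p≤ N*N*400≤u*u))) (^-monoˡ-≤ 4 t≤) ⟩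
      (u * u * (u * u)) ^ 2 * u ^ 4   ≡⟨ powers u ⟩
      (u * u) ^ 6                     ≡⟨ u*u^6 ⟩
      (N * N * 160000) ^ 6            ∎
      where
      open ≤-Reasoning
      fourth : ∀ u → u * u * (u * u) ≡ u * (u * (u * (u * 1)))
      fourth = solve-∀
      powers : ∀ u → (u * u * (u * u)) ^ 2 * u ^ 4 ≡ (u * u) ^ 6
      powers u = begin-equality
        (u * u * (u * u)) ^ 2 * u ^ 4  ≡⟨ cong (λ v → v ^ 2 * u ^ 4) (fourth u) ⟩
        (u ^ 4) ^ 2 * u ^ 4            ≡⟨ cong (_* u ^ 4) (^-*-assoc u 4 2) ⟩
        u ^ 8 * u ^ 4                  ≡⟨ ^-distribˡ-+-* u 8 4 ⟨
        u ^ 12                         ≡⟨ ^-distribˡ-+-* u 6 6 ⟩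
        u ^ 6 * u ^ 6                  ≡⟨ ^-distribʳ-* u u 6 ⟨
        (u * u) ^ 6                    ∎

  sixthPower≤ : ∀ R → sixthPower (knapsack x (sideOf R)) R ≤ (N * N * 160000) ^ 6
  sixthPower≤ `t√p-max                 = balanced (T≤N*400 x) (fine-max≤ x weightsCoarse)
  sixthPower≤ `⟨n·w-max·p-max⟩^⅓·t^⅔   =
    balanced′ (items≤ x) (coarse-max≤ x weightsCoarse) (fine-max≤ x weightsCoarse) (T≤N*400 x)
  sixthPower≤ `OPT√w-max               = balanced (OPT≤N*400 x) (fine-max≤ x profitsCoarse)
  sixthPower≤ `⟨n·w-max·p-max⟩^⅓·OPT^⅔ = subst (_≤ (N * N * 160000) ^ 6)
    (cong (λ s → s ^ 2 * KnapsackInstance.OPT (knapsack x profitsCoarse) ^ 4)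
      (exchange items (KnapsackInstance.p-max (knapsack x profitsCoarse)) (KnapsackInstance.w-max (knapsack x profitsCoarse))))
    (balanced′ (items≤ x) (coarse-max≤ x profitsCoarse) (fine-max≤ x profitsCoarse) (OPT≤N*400 x))
    where
    exchange : ∀ n p w → n * p * w ≡ n * w * p
    exchange = solve-∀

  private
    N*400≤N*N*400 : N * 400 ≤ N * N * 400
    N*400≤N*N*400 = *-monoˡ-≤ 400 (m≤m*n N N {{>-nonZero N>0}})

    N≤2^ : N ≤ 2 ^ bitLength N
    N≤2^ = <⇒≤ (n<2^bitLength N)

  inputs≤ : ∀ side → All.All (_≤ N * N * 400) (Problem.input Knapsack (knapsack x side))
  inputs≤ side = ≤-trans (items≤ x) N*400≤N*N*400 All.∷ go side
    where
    go : ∀ side → All.All (_≤ N * N * 400) (KnapsackInstance.capacity (knapsack x side) ∷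
      toList (KnapsackInstance.weights (knapsack x side)) ++ toList (KnapsackInstance.profits (knapsack x side)))
    go weightsCoarse = ≤-trans (T≤N*400 x) N*400≤N*N*400 All.∷
      ++⁺ (all-tabulate weightᶠ (λ p → ≤-trans (coarse≤ p) N*400≤N*N*400)) (all-tabulate profitᶠ fine≤)
      where open ReducedItems x weightsCoarse
    go profitsCoarse = fineTarget≤ x All.∷
      ++⁺ (all-tabulate weightᶠ fine≤) (all-tabulate profitᶠ (λ p → ≤-trans (coarse≤ p) N*400≤N*N*400))
      where open ReducedItems x profitsCoarse

  logNU≤ : ∀ side → Problem.logNU Knapsack (knapsack x side) ≤ bitLength N * 22
  logNU≤ side = logNU-bound (knapsack x side) {N} (items≤ x) (inputs≤ side)

  -- The input starts with N, so its maximum is positive.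
  bitLength≤logNU : bitLength N ≤ Problem.logNU BoundedMinPlusVerification x
  bitLength≤logNU = bitLength-mono (m≤m*n N _ {{>-nonZero (≤-trans N>0 (All.head (xs≤max 0 sequences)))}})

  -- The summand 22 κ accommodates the words of the Knapsack program, by `logNU≤`; 13 is for the
  -- prologue's own numbers, up to 1024 N².
  wordSize : ℕ → ℕ
  wordSize κ = 2 ^ ((κ * 22 + 13) * Problem.logNU BoundedMinPlusVerification x)

  wide : ∀ κ → N * N * 1024 < wordSize κ
  wide κ = <-≤-trans (≤-<-trans (n*n*1024≤ N (2 ^ bitLength N) (2≤2^bitLength N) N≤2^) (^<2^ N {12} {13} ≤-refl))
    (^-monoʳ-≤ 2 (≤-trans (≤-reflexive (*-comm (bitLength N) 13)) (*-mono-≤ (m≤n+m 13 (κ * 22)) bitLength≤logNU)))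

  wordSize-≥ : ∀ κ side → 2 ^ (κ * Problem.logNU Knapsack (knapsack x side)) ≤ wordSize κ
  wordSize-≥ κ side = ^-monoʳ-≤ 2 (≤-trans (*-monoʳ-≤ κ (logNU≤ side))
    (≤-trans (≤-reflexive (regroup κ (bitLength N) 22)) (*-mono-≤ (m≤m+n (κ * 22) 13) bitLength≤logNU)))
    where
    regroup : ∀ k l c → k * (l * c) ≡ k * c * l
    regroup = solve-∀

-- The verification program

-- Register 20 is the callee's output register 0 after relocation. An optimum below the threshold
-- means that no violating triple exists, hence answer 1.
epilogue : ∀ {m} → Side → ℕ → Program m
epilogue side exit =
  jumpLess 20 (thresholdReg side) (3 + exit) ∷ const 0 0 ∷ halt ∷ const 0 1 ∷ halt ∷ []

verifier : ∀ {m} → Side → Program m → Program m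
verifier side P = Subroutine.whole (prologue side) (epilogue side (38 + length P)) P

run-halt : ∀ {m W T} (P : Program m) {pc ρ μ} → head (drop pc P) ≡ just halt → (bs : Vec Bool (suc T)) →
           run W P bs ⟨ pc , ρ , μ ⟩ ≡ just (ρ 0)
run-halt P at (b ∷ bs) rewrite at = refl

module _ {m} (x : ConvolutionInstance) (side : Side) (P : Program m) {W W′ : ℕ}
  (W≤W′ : W ≤ W′) (wide : Source.N x * Source.N x * 1024 < W′) where
  open Source x
  open Items side N val
  private
    exit : ℕ
    exit = 38 + length P

    open module S = Subroutine (prologue side) (epilogue side exit) P hiding (exit)
    open PrologueRun side (map relocate P ++ epilogue side exit) N W′ N>0 wide val val≤N

    y : KnapsackInstance
    y = knapsack x side

    1<W′ : 1 < W′
    1<W′ = ≤-<-trans (*-mono-≤ (*-mono-≤ N>0 N>0) (s≤s z≤n)) wide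

    at-post : ∀ i {instr} → head (drop i (epilogue side exit)) ≡ just instr → head (drop (i + exit) whole) ≡ just instr
    at-post i at = trans (cong head (fetch-post i)) at

    thresholdReg<20 : ∀ side → thresholdReg side < 20
    thresholdReg<20 weightsCoarse = m≤m+n 11 9
    thresholdReg<20 profitsCoarse = m≤m+n 10 10

    -- Comparison, constant and halt are the three steps for which the caller reserves coins after
    -- the call.
    finish : ∀ {θ v T c} → θ (thresholdReg side) ≡ threshold → (ds : Vec Bool T) → 3 ≤ T → Exits θ v c →
             run W′ whole ds c ≡ just (bit (v <ᵇ threshold))
    finish {v = v} θ≡ (b₁ ∷ b₂ ∷ b₃ ∷ ds) 3≤T (exits {ρ} {μ} ρ20≡v kept) with v <? threshold
    ... | yes v<t rewrite <ᵇ-true v<t =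
      trans (run-Steps (step-less whole {pc = exit} {ρ} {μ} (at-post 0 refl) ρ20≡v
               (trans (kept _ (thresholdReg<20 side)) θ≡) v<t
             then step-const whole (at-post 3 refl) 1<W′ then done) (b₁ ∷ b₂ ∷ []) (b₃ ∷ ds))
            (run-halt {W = W′} whole {4 + exit} {ρ [ 0 ≔ 1 ]} {μ} (at-post 4 refl) (b₃ ∷ ds))
    ... | no v≮t rewrite <ᵇ-false (≮⇒≥ v≮t) =
      trans (run-Steps (step-notLess whole {pc = exit} {ρ} {μ} (at-post 0 refl) ρ20≡v
               (trans (kept _ (thresholdReg<20 side)) θ≡) (≮⇒≥ v≮t)
             then step-const whole (at-post 1 refl) (<-trans (s≤s z≤n) 1<W′) then done) (b₁ ∷ b₂ ∷ []) (b₃ ∷ ds))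
            (run-halt {W = W′} whole {2 + exit} {ρ [ 0 ≔ 0 ]} {μ} (at-post 2 refl) (b₃ ∷ ds))
    finish θ≡ (b ∷ [])      (s≤s ())
    finish θ≡ (b ∷ b′ ∷ []) (s≤s (s≤s ()))

    prepared-simulates : ∀ {c} → Prepared c → Simulates (reg c) (initial (Problem.input Knapsack y)) c
    prepared-simulates {c} prep = simulates at-38 cleared same (λ _ _ → refl)
      where
      open Prepared prep
      same : mem c ≗ mem (initial (Problem.input Knapsack y))
      same zero          = trans mem-size (cong (_∸ 1) (sym 1+items))
      same (suc zero)    = mem-limit
      same (suc (suc i)) = entries-tabulate (weight ∘ suc) (profit ∘ suc) {μ = λ j → mem c (2 + j)}
        (λ j j< → trans (cong (mem c) (+-comm 1 (suc j))) (mem-weight (suc j) (s≤s z≤n) (<4N j<)))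
        (λ j j< → trans (cong (mem c) (trans (sym (+-suc (suc items) j)) (cong (_+ suc j) 1+items)))
                        (mem-profit (suc j) (s≤s z≤n) (<4N j<)))
        (λ j → mem-beyond _ (subst (λ z → z + z ≤ 2 + (items + (items + j))) 1+items
          (≤-trans (m≤m+n _ j) (≤-reflexive (regroup items j)))))
        i
        where
        <4N : ∀ {j} → j < items → suc j < N + N + (N + N)
        <4N {j} j< = subst (suc j <_) 1+items (s≤s j<)
        regroup : ∀ n j → suc n + suc n + j ≡ 2 + (n + (n + j))
        regroup = solve-∀

  verifier-succeeds : ∀ {T} → Succeeds W P (Problem.input Knapsack y) (KnapsackInstance.OPT y) T →
    ∃[ k ] k ≤ 18 + ((N + N + (N + N)) * 14 + 3) ×
      Succeeds W′ (verifier side P) sequences (bit (does verified?)) (k + (T + 3))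
  verifier-succeeds {T} success =
    let k , k≤ , c , steps , prep = prepare refl (λ _ _ _ → refl) val-beyond
    in k , k≤ , succeeds-framed k T 3
      (λ cs ds es correct → begin
        run W′ whole (cs Vec.++ (ds Vec.++ es)) (initial sequences)  ≡⟨ run-Steps steps cs (ds Vec.++ es) ⟩
        run W′ whole (ds Vec.++ es) c
          ≡⟨ run-simulated W≤W′ (prepared-simulates prep) ds correct es (finish (Prepared.threshold′ prep)) ⟩
        just (bit (KnapsackInstance.OPT y <ᵇ threshold))             ≡⟨ cong (just ∘ bit) (OPT<threshold-correct x side) ⟩
        just (bit (does verified?))                                  ∎)
      success
    where open ≡-Reasoning

-- Choice of `ε` and total running time

positive-numerator : ∀ δ → Positive δ → 0 < ℤ.∣ ℚ.numerator δ ∣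
positive-numerator (mkℚ ℤ.+[1+ n ] d coprime) _ = s≤s z≤n
positive-numerator (mkℚ (ℤ.+ zero) d coprime) record { pos = () }
positive-numerator (mkℚ ℤ.-[1+ n ] d coprime) record { pos = () }

theorem6 : (m : Mode) (R : Expression) (z : Parameter) →
    (∃[ δ ] Positive δ × KnapsackIn-Õ[n+ R / z ^ δ ] m) →
    ∃[ ε ] Positive ε × VerificationIn-O[n^2- ε ] m
theorem6 m R z (δ@(mkℚ _ d _) , δ>0 , c , C , P , κ , solves) =
  let D , polylog = [1+C*L^c]^k≤linear C c 22 (b + b)
  in ε , _ , 2 * (D * (160000 ^ (b + b) + 480 ^ (b + b))) , verifier side P , κ * 22 + 13 , λ x →
    let open ConvolutionInstance x using () renaming (n to N; n>0 to N>0)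
        y                = knapsack x side
        L                = Problem.logNU Knapsack y
        T , fast , right = solves y
        k , k≤ , right′  = verifier-succeeds x side P (wordSize-≥ x κ side) (wide x κ) right
    in k + (T + 3)
     , subquadratic {T ∸ C * L ^ c * Source.items x} {1 + C * L ^ c} {N} {160000} {480} {D} b (s≤s z≤n) N>0
         (polylog N L N>0 (s≤s z≤n) (logNU≤ x side))
         (≤-trans
           (dominant {T ∸ C * L ^ c * Source.items x} {value y z} {C * L ^ c} {N} {160000} {sixthPower y R} a b
             (positive-numerator δ δ>0) N>0 (z≥N x side z) (sixthPower≤ x R) fast)
           (^-monoˡ-≤ b (*-monoˡ-≤ (N * N * 160000) (n≤1+n (C * L ^ c)))))
         (total-time {k} {T} {C * L ^ c} {N} {Source.items x} N>0 (items≤ x) k≤)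
     , right′
  where
  side = sideOf R
  a = ℤ.∣ ℚ.numerator δ ∣
  b = suc d
  ε : ℚ
  -- Denominators are stored minus one, so that of `ε` evaluates to `b + b`.
  ε = mkℚ (ℤ.+ 1) (d + suc d) (1-coprimeTo (b + b))
  -- 480 = 400 + 24 + 56: 400 bounds the number of items per N, 24 = 18 + 3 + 3 counts the steps
  -- outside the loop, and 56 = 4 · 14 those of the loop per N.
  total-time : ∀ {k T K N n} → 0 < N → n ≤ N * 400 → k ≤ 18 + ((N + N + (N + N)) * 14 + 3) →
               k + (T + 3) ≤ T ∸ K * n + (1 + K) * 480 * N
  total-time {k} {T} {K} {N} {n} N>0 n≤ k≤ = begin
    k + (T + 3)                                                     ≤⟨ +-mono-≤ k≤ (+-monoˡ-≤ 3 (m≤n+m∸n T (K * n))) ⟩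
    18 + ((N + N + (N + N)) * 14 + 3) + (K * n + X + 3)             ≡⟨ gather N (K * n) X ⟩
    X + (K * n + (24 + N * 56))                                     ≤⟨ +-monoʳ-≤ X (+-mono-≤ (*-monoʳ-≤ K n≤) (+-monoˡ-≤ (N * 56) (*-monoˡ-≤ 24 N>0))) ⟩
    X + (K * (N * 400) + (N * 24 + N * 56))                         ≤⟨ +-monoʳ-≤ X (m≤m+n _ (N * 400 + K * N * 80)) ⟩
    X + (K * (N * 400) + (N * 24 + N * 56) + (N * 400 + K * N * 80))  ≡⟨ cong (λ z → X + z) (collect K N) ⟩
    X + (1 + K) * 480 * N                                           ∎
    where
    open ≤-Reasoning
    X = T ∸ K * n
    gather : ∀ n y x → 18 + ((n + n + (n + n)) * 14 + 3) + (y + x + 3) ≡ x + (y + (24 + n * 56))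
    gather = solve-∀
    collect : ∀ k n → k * (n * 400) + (n * 24 + n * 56) + (n * 400 + k * n * 80) ≡ (1 + k) * 480 * n
    collect = solve-∀
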